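{- Let $\mathcal{G}$ be a hereditary class of graphs. The parameters $\mathrm{tree}\text{ - }\alpha$ and $\mathrm{tree}\text{ - }\mu$ are functionally equivalent in $\mathcal{G}$ if and only if $\mathcal{G}$ does not contain all complete bipartite graphs.
   Context: All graphs are finite, simple, undirected, and have at least one vertex. A graph class is a class of graphs closed under isomorphism; it is hereditary if it is closed under vertex deletion (equivalently, under taking induced subgraphs). Two graph parameters $p$ and $q$ (with values in the nonnegative integers) are functionally equivalent in $\mathcal{G}$ if each can be bounded by a function of the other on $\mathcal{G}$, i.e., there exist functions $f,g$ from nonnegative integers to nonnegative integers such that $p(G)\leq f(q(G))$ and $q(G)\leq g(p(G))$ for every $G\in\mathcal{G}$. For $X\subseteq V(G)$, $\alpha(X)$ denotes the maximum size of an independent set of $G$ contained in $X$. A tree decomposition of a graph $G$ is a pair $\mathcal{T}=(T,\beta)$ where $T$ is a tree and $\beta$ maps each node $x$ of $T$ to a set $\beta(x)\subseteq V(G)$ (a bag) such that: (1) every vertex of $G$ belongs to some bag; (2) for every edge $uv$ of $G$, some bag contains both $u$ and $v$; (3) for every vertex $v$ of $G$, the set $\{x\in V(T)\mid v\in\beta(x)\}$ induces a connected subgraph of $T$. An induced matching in $G$ is a set $M$ of pairwise disjoint edges of $G$ such that no vertex of one edge of $M$ is adjacent in $G$ to a vertex of a different edge of $M$. An induced matching $M$ touches a set $X\subseteq V(G)$ if every edge of $M$ has at least one endpoint in $X$. For a tree decomposition $\mathcal{T}=(T,\beta)$ of $G$: $\alpha(\mathcal{T})=\max_{x\in V(T)}\alpha(\beta(x))$,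 and $\mu(\mathcal{T})$ is the maximum, over $x\in V(T)$, of the maximum size of an induced matching in $G$ that touches $\beta(x)$. The tree-independence number $\mathrm{tree}\text{ - }\alpha(G)$ is the minimum of $\alpha(\mathcal{T})$, and the induced matching treewidth $\mathrm{tree}\text{ - }\mu(G)$ is the minimum of $\mu(\mathcal{T})$, over all tree decompositions $\mathcal{T}$ of $G$. -}

module Defs where

open import Level using (Level; 0ℓ; _⊔_) renaming (suc to lsuc)
open import Data.Nat using (ℕ; zero; suc; _+_; _≤_)
open import Data.Fin using (Fin; zero; suc; inject₁; fromℕ; punchIn; splitAt)
open import Data.Fin.Subset using (Subset; _∈_; _⊆_; ∣_∣)
open import Data.Product using (Σ; ∃; ∃-syntax; _×_; _,_)
open import Data.Sum using (_⊎_; inj₁; inj₂)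
open import Data.Empty using (⊥)
open import Data.Unit using (⊤; tt)
open import Function.Bundles using (_⇔_; _↔_; Inverse)
open import Function.Definitions using (Injective)
open import Relation.Nullary using (¬_; yes; no)
open import Relation.Unary using (Pred)
open import Relation.Binary.Core using (Rel)
open import Relation.Binary.Definitions using (Decidable; Symmetric)
open import Relation.Binary.PropositionalEquality using (_≡_; _≢_)
open import Relation.Binary.Construct.Closure.ReflexiveTransitive using (Star)

private
  variable
    ℓ : Level
    m n : ℕ

-- Finite simple graphs with vertex set Fin n.  The requirement that a graph
-- has at least one vertex is imposed where graphs are quantified over, by
-- using the type Graph (suc n).
record Graph (n : ℕ) : Set₁ where
  field
    Adj    : Rel (Fin n) 0ℓ
    adj?   : Decidable Adj
    sym    : Symmetric Adj
    irrefl : ∀ {u} → ¬ Adj u u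

open Graph public using (Adj)

record _≅_ (G : Graph m) (H : Graph n) : Set where
  field
    bijection : Fin m ↔ Fin n
    preserves : ∀ u v → Adj G u v ⇔ Adj H (Inverse.to bijection u) (Inverse.to bijection v)

-- punchIn v enumerates the vertices other than v.
delete : Graph (suc n) → Fin (suc n) → Graph n
delete G v = record
  { Adj    = λ x y → Adj G (punchIn v x) (punchIn v y)
  ; adj?   = λ x y → Graph.adj? G (punchIn v x) (punchIn v y)
  ; sym    = Graph.sym G
  ; irrefl = Graph.irrefl G
  }

record GraphClass (ℓ : Level) : Set (lsuc 0ℓ ⊔ lsuc ℓ) where
  field
    Member     : Graph (suc n) → Set ℓ
    iso-closed : {G : Graph (suc m)} {H : Graph (suc n)} → G ≅ H → Member G → Member H

open GraphClass public using (Member)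

-- Only graphs with at least two vertices admit a vertex deletion, since every
-- graph has at least one vertex.
Hereditary : GraphClass ℓ → Set (lsuc 0ℓ ⊔ ℓ)
Hereditary 𝒢 = ∀ {n} (G : Graph (suc (suc n))) (v : Fin (suc (suc n))) →
               Member 𝒢 G → Member 𝒢 (delete G v)

OppositeSides : Rel (Fin m ⊎ Fin n) 0ℓ
OppositeSides (inj₁ _) (inj₁ _) = ⊥
OppositeSides (inj₁ _) (inj₂ _) = ⊤
OppositeSides (inj₂ _) (inj₁ _) = ⊤
OppositeSides (inj₂ _) (inj₂ _) = ⊥

private
  opposite? : Decidable (OppositeSides {m} {n})
  opposite? (inj₁ _) (inj₁ _) = no λ ()
  opposite? (inj₁ _) (inj₂ _) = yes tt
  opposite? (inj₂ _) (inj₁ _) = yes tt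
  opposite? (inj₂ _) (inj₂ _) = no λ ()

  opposite-sym : (s t : Fin m ⊎ Fin n) → OppositeSides s t → OppositeSides t s
  opposite-sym (inj₁ _) (inj₂ _) _ = tt
  opposite-sym (inj₂ _) (inj₁ _) _ = tt

  opposite-irrefl : (s : Fin m ⊎ Fin n) → ¬ OppositeSides s s
  opposite-irrefl (inj₁ _) ()
  opposite-irrefl (inj₂ _) ()

-- The first m vertices form one side, the last n the other.
K[_,_] : (m n : ℕ) → Graph (m + n)
K[ m , n ] = record
  { Adj    = λ u v → OppositeSides (splitAt m u) (splitAt m v)
  ; adj?   = λ u v → opposite? (splitAt m u) (splitAt m v)
  ; sym    = λ {u} {v} → opposite-sym (splitAt m u) (splitAt m v)
  ; irrefl = λ {u} → opposite-irrefl (splitAt m u)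
  }

-- The subgraph of G induced by X is connected (or empty): any two vertices of
-- X are joined by a walk that stays inside X.
ConnectedOn : Graph n → Pred (Fin n) 0ℓ → Set
ConnectedOn G X = ∀ u v → X u → X v → Star (λ x y → Adj G x y × X x × X y) u v

Connected : Graph n → Set
Connected G = ∀ u v → Star (Adj G) u v

record Cycle (G : Graph n) : Set where
  field
    {k}      : ℕ
    vertex   : Fin (3 + k) → Fin n
    distinct : Injective _≡_ _≡_ vertex
    step     : ∀ i → Adj G (vertex (inject₁ i)) (vertex (suc i))
    closing  : Adj G (vertex (fromℕ (2 + k))) (vertex zero)

record IsTree (T : Graph (suc n)) : Set where
  field
    connected : Connected T
    acyclic   : ¬ Cycle T

record TreeDecomposition (G : Graph n) : Set₁ where
  field
    {t}             : ℕ
    T               : Graph (suc t)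
    isTree          : IsTree T
    bag             : Fin (suc t) → Subset n
    covers-vertices : ∀ v → ∃[ x ] v ∈ bag x
    covers-edges    : ∀ u v → Adj G u v → ∃[ x ] (u ∈ bag x × v ∈ bag x)
    coherent        : ∀ v → ConnectedOn T (λ x → v ∈ bag x)

Independent : Graph n → Subset n → Set
Independent G S = ∀ u v → u ∈ S → v ∈ S → ¬ Adj G u v

-- An induced matching consisting of k edges, enumerated (with an arbitrary
-- orientation) as left i — right i.  As edges with different indices are
-- disjoint, the enumeration has no repetitions.
record InducedMatching (G : Graph n) (k : ℕ) : Set where
  field
    left right : Fin k → Fin n
    edge       : ∀ i → Adj G (left i) (right i)

  _endOf_ : Fin n → Fin k → Set
  u endOf i = u ≡ left i ⊎ u ≡ right i

  field
    disjoint : ∀ {i j u v} → i ≢ j → u endOf i → v endOf j → u ≢ v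
    induced  : ∀ {i j u v} → i ≢ j → u endOf i → v endOf j → ¬ Adj G u v

Touches : {G : Graph n} {k : ℕ} → InducedMatching G k → Subset n → Set
Touches M X = ∀ i → left i ∈ X ⊎ right i ∈ X
  where open InducedMatching M

-- Extremal quantities are given by their graphs: "the value is k" is a
-- relation.  Values are unique by antisymmetry; below, classically, they also
-- always exist: every set being maximised over is nonempty and bounded, and
-- every graph has a one-bag tree decomposition.
IsMaximum : Pred ℕ ℓ → ℕ → Set ℓ
IsMaximum P k = P k × (∀ j → P j → j ≤ k)

IsMinimum : Pred ℕ ℓ → ℕ → Set ℓ
IsMinimum P k = P k × (∀ j → P j → k ≤ j)

-- The independence number α(X) of the vertex set X is k.
α-of : Graph n → Subset n → ℕ → Set
α-of G X = IsMaximum λ k → ∃[ S ] (Independent G S × S ⊆ X × ∣ S ∣ ≡ k)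

-- The maximum size of an induced matching of G touching X is k.
μ-of : Graph n → Subset n → ℕ → Set
μ-of G X = IsMaximum λ k → Σ (InducedMatching G k) λ M → Touches M X

α[_]≡_ : {G : Graph n} → TreeDecomposition G → ℕ → Set
α[_]≡_ {G = G} 𝒯 = IsMaximum λ k → ∃[ x ] α-of G (TreeDecomposition.bag 𝒯 x) k

μ[_]≡_ : {G : Graph n} → TreeDecomposition G → ℕ → Set
μ[_]≡_ {G = G} 𝒯 = IsMaximum λ k → ∃[ x ] μ-of G (TreeDecomposition.bag 𝒯 x) k

-- A graph parameter, as the relation "the value at G is k".
Parameter : Set₂
Parameter = ∀ {n} → Graph (suc n) → ℕ → Set₁

tree-α : Parameter
tree-α G = IsMinimum λ k → Σ (TreeDecomposition G) λ 𝒯 → α[ 𝒯 ]≡ k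

tree-μ : Parameter
tree-μ G = IsMinimum λ k → Σ (TreeDecomposition G) λ 𝒯 → μ[ 𝒯 ]≡ k

-- p(G) ≤ f(q(G)) for every G in 𝒢.
BoundedVia : (ℕ → ℕ) → GraphClass ℓ → Parameter → Parameter → Set (lsuc 0ℓ ⊔ ℓ)
BoundedVia f 𝒢 p q = ∀ {n} (G : Graph (suc n)) → Member 𝒢 G →
                     ∀ {a b} → p G a → q G b → a ≤ f b

FunctionallyEquivalent : GraphClass ℓ → Parameter → Parameter → Set (lsuc 0ℓ ⊔ ℓ)
FunctionallyEquivalent 𝒢 p q =
  ∃[ f ] ∃[ g ] (BoundedVia f 𝒢 p q × BoundedVia g 𝒢 q p)

-- Some complete bipartite graph (with both sides nonempty) is not in 𝒢; this
-- is the constructive form of "not all complete bipartite graphs are in 𝒢".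
OmitsCompleteBipartite : GraphClass ℓ → Set ℓ
OmitsCompleteBipartite 𝒢 = ∃[ m ] ∃[ n ] ¬ Member 𝒢 K[ suc m , suc n ]

{-# OPTIONS --safe #-}
-- Bicliques have tree-μ at most 1, while every tree decomposition has a bag
-- containing a closed neighbourhood, so tree-α of K_{N,N} is at least N.
--
-- Conversely let G have no induced K_{t,t} and a tree decomposition with
-- μ = b.  Call a vertex big if its neighbourhood contains an independent set of
-- a suitable constant size c.  By Ramsey's theorem, many independent big
-- vertices in one bag would yield an induced matching of size b + 1 touching
-- it.  Take a maximal induced matching of the subgraph induced by the small
-- vertices; the small vertices with no neighbour in it form an independent set
-- I.  Move every v in I to a new leaf with bag N[v], adding its neighbours to
-- the bags that contained v.  The bags N[v] are fine as v is small.  In an old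
-- bag, a vertex that is not big starts an edge touching the original bag and
-- ending in a small vertex of I or of the matching.  These end vertices induce a
-- triangle-free graph, so by Ramsey's theorem again many independent such
-- vertices would give an induced matching of size b + 1.
--
-- The inequalities to be proved are decidable, so one may argue classically
-- under double negation.

module Submission where

open import Defs
open import Function.Base using (_∘_; _on_; id; case_of_)
open import Function.Bundles using (_⇔_; mk⇔; mk↔ₛ′; Equivalence)
open import Function.Definitions using (Injective)
open import Effect.Monad using (RawMonad)
open import Level using (Level; 0ℓ)
open import Data.Empty using (⊥; ⊥-elim)
open import Data.Nat using (ℕ; zero; suc; _+_; _≤_; _<_; z≤n; s≤s; _≤?_)
open import Data.Nat.Properties
open import Data.Unit using (⊤)
open import Data.Fin using (Fin; zero; suc; toℕ; fromℕ; inject₁; inject≤; splitAt; join; _↑ˡ_; _↑ʳ_; punchOut)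
open import Data.Fin.Relation.Unary.Top using (view; ‵fromℕ; ‵inject₁)
import Data.Fin.Properties as Fin
open import Data.Fin.Subset as Subset using (Subset; inside; outside; _∈_; _∉_; _⊆_; _∪_; ⁅_⁆; ∣_∣)
import Data.Fin.Subset.Properties as Subset
open import Data.Vec as Vec using ([]; _∷_; here; there)
import Data.Vec.Properties as Vec
open import Data.List
  using (List; []; _∷_; _++_; length; map; allFin; zipWith; foldr; tabulate; cartesianProduct; lookup)
open import Data.List.Properties using (length-map; length-zipWith; length-tabulate)
open import Data.List.Membership.Propositional using (find; lose) renaming (_∈_ to _∈ˡ_)
open import Data.List.Membership.Propositional.Properties
  using (∈-allFin; ∈-lookup; ∈-filter⁺; ∈-map⁻; ∈-cartesianProduct⁺)
open import Data.List.Relation.Unary.All as All using (All; []; _∷_)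
import Data.List.Relation.Unary.All.Properties as All
open import Data.List.Relation.Unary.AllPairs as AllPairs using (AllPairs; []; _∷_; allPairs?)
import Data.List.Relation.Unary.AllPairs.Properties as AllPairs
import Data.List.Relation.Unary.Unique.Propositional.Properties as Unique
open import Data.List.Relation.Unary.Any as Any using (Any; here; there)
open import Data.List.Relation.Binary.Sublist.Propositional as Sublist
  using ([]; _∷_; _∷ʳ_; minimum; ⊆-refl; ⊆-trans) renaming (_⊆_ to _⊑_)
open import Data.List.Relation.Binary.Sublist.Propositional.Properties using (All-resp-⊆)
open import Data.Product using (Σ; ∃; ∃-syntax; _×_; _,_; proj₁; proj₂)
open import Data.Sum as Sum using (_⊎_; inj₁; inj₂; [_,_]′)
open import Relation.Nullary
  using (¬_; Dec; yes; no; does; contradiction; toSum; decidable-stable; ¬?; _×-dec_; _⊎-dec_)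
open import Relation.Nullary.Decidable using (dec-true; map′; ¬¬-excluded-middle)
open import Relation.Nullary.Negation using (¬¬-Monad)
open import Relation.Unary using (Pred)
open import Relation.Binary.Core using (Rel)
open import Relation.Binary.Definitions using (Decidable; Symmetric)
open import Relation.Binary.PropositionalEquality
  using (_≡_; _≢_; refl; sym; trans; cong; subst; subst₂; ≢-sym)
open import Relation.Binary.Construct.Closure.ReflexiveTransitive as Star using (Star; ε; _◅_; _◅◅_)

private
  variable
    a ℓ : Level
    A B I : Set a
    k n : ℕ

-- Lists and Ramsey's theorem

AllPairs-resp-⊑ : {R : Rel A ℓ} {xs ys : List A} → ys ⊑ xs → AllPairs R xs → AllPairs R ys
AllPairs-resp-⊑ []         []         = []
AllPairs-resp-⊑ (_ ∷ʳ s)   (_ ∷ rs)   = AllPairs-resp-⊑ s rs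
AllPairs-resp-⊑ (refl ∷ s) (r ∷ rs)   = All-resp-⊆ s r ∷ AllPairs-resp-⊑ s rs

AllPairs-++⁻ : {R : Rel A ℓ} (xs : List A) {ys : List A} → AllPairs R (xs ++ ys) →
               AllPairs R xs × All (λ x → All (R x) ys) xs × AllPairs R ys
AllPairs-++⁻ []       rs       = [] , [] , rs
AllPairs-++⁻ (x ∷ xs) (r ∷ rs) =
  let rs₁ , rs₂ , rs₃ = AllPairs-++⁻ xs rs ; r₁ , r₂ = All.++⁻ xs r in r₁ ∷ rs₁ , r₂ ∷ rs₂ , rs₃

AllPairs-∈ : {R : Rel A ℓ} {xs : List A} {x y : A} → Symmetric R → AllPairs R xs →
             x ∈ˡ xs → y ∈ˡ xs → x ≡ y ⊎ R x y
AllPairs-∈ _     (_ ∷ _)  (here refl) (here refl) = inj₁ refl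
AllPairs-∈ _     (r ∷ _)  (here refl) (there y∈)  = inj₂ (All.lookup r y∈)
AllPairs-∈ sym-R (r ∷ _)  (there x∈)  (here refl) = inj₂ (sym-R (All.lookup r x∈))
AllPairs-∈ sym-R (_ ∷ rs) (there x∈)  (there y∈)  = AllPairs-∈ sym-R rs x∈ y∈

AllPairs-lookup : {R : Rel A ℓ} {xs : List A} → Symmetric R → AllPairs R xs →
                  ∀ {i j} → i ≢ j → R (lookup xs i) (lookup xs j)
AllPairs-lookup sym-R (_ ∷ _)  {zero}  {zero}  i≢j = contradiction refl i≢j
AllPairs-lookup sym-R (r ∷ _)  {zero}  {suc j} _   = All.lookup r (∈-lookup j)
AllPairs-lookup sym-R (r ∷ _)  {suc i} {zero}  _   = sym-R (All.lookup r (∈-lookup i))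
AllPairs-lookup sym-R (_ ∷ rs) {suc i} {suc j} i≢j = AllPairs-lookup sym-R rs (i≢j ∘ cong suc)

All-zipWith⁺ : {C : Set a} {P : Pred C ℓ} {f : A → B → C} (xs : List A) (ys : List B) →
               All (λ x → All (λ y → P (f x y)) ys) xs → All P (zipWith f xs ys)
All-zipWith⁺ []       _        _          = []
All-zipWith⁺ (_ ∷ _)  []       _          = []
All-zipWith⁺ (x ∷ xs) (y ∷ ys) ((p ∷ _) ∷ ps) = p ∷ All-zipWith⁺ xs ys (All.map All.tail ps)

-- Finite choice: a list of vertices becomes a list of claws centred at them, or of edges starting
-- at them, in the same order.
All-lift : {P : Pred B ℓ} {f : B → A} {xs : List A} → All (λ x → ∃[ y ] (f y ≡ x × P y)) xs →
           ∃[ ys ] (map f ys ≡ xs × All P ys)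
All-lift []                     = [] , refl , []
All-lift ((y , refl , p) ∷ ps) with All-lift ps
... | ys , refl , qs = y ∷ ys , refl , p ∷ qs

split-length : (p q : ℕ) (xs : List A) → p + q ≤ length xs →
               ∃[ ys ] ∃[ zs ] (xs ≡ ys ++ zs × p ≤ length ys × q ≤ length zs)
split-length zero    q xs       q≤     = [] , xs , refl , z≤n , q≤
split-length (suc p) q (x ∷ xs) (s≤s le) with split-length p q xs le
... | ys , zs , refl , p≤ , q≤ = x ∷ ys , zs , refl , s≤s p≤ , q≤

∃Sublist : (P : List A → Set ℓ) → ℕ → List A → Set _
∃Sublist P k xs = ∃[ ys ] (ys ⊑ xs × k ≤ length ys × P ys)

∃Sublist-mono : {P : List A → Set ℓ} {xs ys : List A} → ys ⊑ xs → ∃Sublist P k ys → ∃Sublist P k xs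
∃Sublist-mono ys⊑xs (zs , zs⊑ys , rest) = zs , ⊆-trans zs⊑ys ys⊑xs , rest

partition-⊎ : {P Q : Pred A ℓ} (p q : ℕ) {xs : List A} → All (λ x → P x ⊎ Q x) xs →
              p + q ≤ length xs → ∃Sublist (All P) p xs ⊎ ∃Sublist (All Q) q xs
partition-⊎ zero q _ _ = inj₁ ([] , minimum _ , z≤n , [])
partition-⊎ (suc p) q (inj₁ x ∷ pqs) (s≤s le) with partition-⊎ p q pqs le
... | inj₁ (ys , ys⊑ , p≤ , ps) = inj₁ (_ ∷ ys , refl ∷ ys⊑ , s≤s p≤ , x ∷ ps)
... | inj₂ big                  = inj₂ (∃Sublist-mono (_ ∷ʳ ⊆-refl) big)
partition-⊎ (suc p) zero (inj₂ x ∷ pqs) le = inj₂ ([] , minimum _ , z≤n , [])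
partition-⊎ (suc p) (suc q) (inj₂ x ∷ pqs) le
  with partition-⊎ (suc p) q pqs (≤-trans (≤-reflexive (sym (+-suc p q))) (≤-pred le))
... | inj₁ big                  = inj₁ (∃Sublist-mono (_ ∷ʳ ⊆-refl) big)
... | inj₂ (ys , ys⊑ , q≤ , qs) = inj₂ (_ ∷ ys , refl ∷ ys⊑ , s≤s q≤ , x ∷ qs)

-- An upper bound from the usual recursion, not the exact Ramsey number; the extra `suc` pays for
-- the pivot, the head of the list.
ramsey : ℕ → ℕ → ℕ
ramsey zero    _       = 0
ramsey (suc _) zero    = 0
ramsey (suc p) (suc q) = suc (ramsey p (suc q) + ramsey (suc p) q)

-- `R` need not be symmetric, as the list orders each pair. This admits relations such as adjacency
-- of the source of one edge to the target of a later one.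
∃-homogeneous : {R : Rel A ℓ} → Decidable R → ∀ p q (xs : List A) → ramsey p q ≤ length xs →
                ∃Sublist (AllPairs R) p xs ⊎ ∃Sublist (AllPairs (λ x y → ¬ R x y)) q xs
∃-homogeneous R? zero    _       xs _ = inj₁ ([] , minimum xs , z≤n , [])
∃-homogeneous R? (suc _) zero    xs _ = inj₂ ([] , minimum xs , z≤n , [])
∃-homogeneous R? (suc p) (suc q) (x ∷ xs) (s≤s le)
  with partition-⊎ (ramsey p (suc q)) _ (All.universal (λ y → toSum (R? x y)) xs) le
... | inj₁ (ys , ys⊑ , le₁ , rs) = case ∃-homogeneous R? p (suc q) ys le₁ of λ where
  (inj₁ (zs , zs⊑ , p≤ , hs)) →
    inj₁ (x ∷ zs , refl ∷ ⊆-trans zs⊑ ys⊑ , s≤s p≤ , All-resp-⊆ zs⊑ rs ∷ hs)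
  (inj₂ big) → inj₂ (∃Sublist-mono (x ∷ʳ ys⊑) big)
... | inj₂ (ys , ys⊑ , le₂ , rs) = case ∃-homogeneous R? (suc p) q ys le₂ of λ where
  (inj₁ big) → inj₁ (∃Sublist-mono (x ∷ʳ ys⊑) big)
  (inj₂ (zs , zs⊑ , q≤ , hs)) →
    inj₂ (x ∷ zs , refl ∷ ⊆-trans zs⊑ ys⊑ , s≤s q≤ , All-resp-⊆ zs⊑ rs ∷ hs)

Homogeneous : Rel A ℓ → List A → Set _
Homogeneous R xs = AllPairs R xs ⊎ AllPairs (λ x y → ¬ R x y) xs

multiRamsey : ℕ → ℕ → ℕ
multiRamsey zero    r = r
multiRamsey (suc m) r = ramsey (multiRamsey m r) (multiRamsey m r)

-- Ramsey's theorem is used once per relation; homogeneity already achieved is inherited by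
-- sublists.
∃-multiHomogeneous : {R : I → Rel A ℓ} → (∀ i → Decidable (R i)) → ∀ is r (xs : List A) →
                     multiRamsey (length is) r ≤ length xs →
                     ∃Sublist (λ ys → All (λ i → Homogeneous (R i) ys) is) r xs
∃-multiHomogeneous R? []       r xs le = xs , ⊆-refl , le , []
∃-multiHomogeneous {R = R} R? (i ∷ is) r xs le =
  [ (λ (ys , ys⊑ , le′ , h) → continue ys ys⊑ le′ (inj₁ h))
  , (λ (ys , ys⊑ , le′ , h) → continue ys ys⊑ le′ (inj₂ h)) ]′
  (∃-homogeneous (R? i) _ _ xs le)
  where
  continue : ∀ ys → ys ⊑ xs → multiRamsey (length is) r ≤ length ys → Homogeneous (R i) ys →
             ∃Sublist (λ zs → All (λ j → Homogeneous (R j) zs) (i ∷ is)) r xs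
  continue ys ys⊑ le′ h with ∃-multiHomogeneous R? is r ys le′
  ... | zs , zs⊑ , r≤ , hs = zs , ⊆-trans zs⊑ ys⊑ , r≤ ,
        Sum.map (AllPairs-resp-⊑ zs⊑) (AllPairs-resp-⊑ zs⊑) h ∷ hs

-- Greedy choice: a rejected element conflicts with the list kept so far, and the conflict survives
-- later additions.
∃-maximal : {R : Rel A ℓ} → Symmetric R → Decidable R → (xs : List A) →
            ∃[ ys ] (ys ⊑ xs × AllPairs R ys × (∀ {x} → x ∈ˡ xs → x ∈ˡ ys ⊎ ¬ All (R x) ys))
∃-maximal sym-R R? [] = [] , [] , [] , λ ()
∃-maximal sym-R R? (x ∷ xs) with ∃-maximal sym-R R? xs
... | ys , ys⊑ , rs , maximal with All.all? (R? x) ys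
... | yes r = x ∷ ys , refl ∷ ys⊑ , r ∷ rs , λ where
  (here refl) → inj₁ (here refl)
  (there y∈)  → Sum.map there (λ { ¬r (_ ∷ r′) → ¬r r′ }) (maximal y∈)
... | no ¬r = ys , x ∷ʳ ys⊑ , rs , λ where
  (here refl) → inj₂ ¬r
  (there y∈)  → maximal y∈

-- Extracting induced matchings

-- The `3` stands for a triangle of targets, each `suc c` for a target together with `c` independent
-- neighbours.
edgeBound : ℕ → ℕ → ℕ
edgeBound c k = ramsey 3 (ramsey (suc c) (ramsey (suc c) k))

-- In a homogeneous family of claws, biclique-freeness leaves fewer than t leaf
-- indices whose leaves see later centres and fewer than t whose leaves see
-- earlier ones.  Ramsey's theorem on the remaining indices gives k of them
-- whose leaves in distinct claws are non-adjacent, a 2t-clique of indices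
-- being once more a biclique.
clawSize : ℕ → ℕ → ℕ
clawSize t k = t + (t + ramsey (t + t) k)

vertexPairs : ∀ c → List (Fin (suc c) × Fin (suc c))
vertexPairs c = cartesianProduct (allFin _) (allFin _)

-- The length `2 + (k + t)` covers three needs at once: two claws for a biclique between leaves, `t`
-- centres beside one further claw for a biclique between leaves and centres, and `k` claws to
-- supply the final edges.
clawBound : ℕ → ℕ → ℕ
clawBound t k = multiRamsey (length (vertexPairs (clawSize t k))) (2 + (k + t))

module _ (G : Graph n) where
  open Graph G using (adj?) renaming (Adj to _~_; sym to ~-sym; irrefl to ~-irrefl)

  Apart : Rel (Fin n) 0ℓ
  Apart u v = u ≢ v × ¬ u ~ v

  Apart-sym : Symmetric Apart
  Apart-sym (u≢v , u≁v) = ≢-sym u≢v , u≁v ∘ ~-sym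

  record Edge : Set where
    constructor mkEdge
    field
      {src tgt} : Fin n
      src~tgt   : src ~ tgt

  open Edge

  -- Edges with no edge between them are automatically disjoint.
  record Separated (e f : Edge) : Set where
    constructor separated
    field
      src≁src : ¬ src e ~ src f
      src≁tgt : ¬ src e ~ tgt f
      tgt≁src : ¬ tgt e ~ src f
      tgt≁tgt : ¬ tgt e ~ tgt f

  Separated-sym : Symmetric Separated
  Separated-sym (separated ss st ts tt) =
    separated (ss ∘ ~-sym) (ts ∘ ~-sym) (st ∘ ~-sym) (tt ∘ ~-sym)

  SmallStar : ℕ → Fin n → Set
  SmallStar c v = ∀ us → AllPairs Apart us → All (v ~_) us → ¬ c ≤ length us

  -- This excludes an induced K_{t,t}: the two sides are disjoint because a common vertex would be
  -- adjacent to itself.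
  BicliqueFree : ℕ → Set
  BicliqueFree t = ∀ us vs → AllPairs Apart us → AllPairs Apart vs →
                   All (λ u → All (u ~_) vs) us → t ≤ length us → ¬ t ≤ length vs

  -- The sources are non-adjacent from the start. Three relations remain: target to target, source
  -- to later target, target to later source. Each is cleared by one use of Ramsey's theorem.
  ∃-separated-edges : ∀ c k (es : List Edge) →
    AllPairs (Apart on src) es → All (SmallStar c ∘ tgt) es →
    (∀ {e f g} → e ∈ˡ es → f ∈ˡ es → g ∈ˡ es → tgt e ~ tgt f → tgt e ~ tgt g → ¬ tgt f ~ tgt g) →
    edgeBound c k ≤ length es → ∃Sublist (AllPairs Separated) k es
  ∃-separated-edges c k es apart small triangle-free le
    with ∃-homogeneous (λ e f → adj? (tgt e) (tgt f)) 3 _ es le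
  ... | inj₁ (e ∷ f ∷ g ∷ _ , es′⊑ , _ , (ef ∷ eg ∷ _) ∷ (fg ∷ _) ∷ _) =
    ⊥-elim (triangle-free (∈es (here refl)) (∈es (there (here refl)))
      (∈es (there (there (here refl)))) ef eg fg)
    where
    ∈es : ∀ {d} → d ∈ˡ (e ∷ f ∷ g ∷ _) → d ∈ˡ es
    ∈es = Sublist.lookup es′⊑
  ... | inj₁ (_ ∷ _ ∷ [] , _ , s≤s (s≤s ()) , _)
  ... | inj₁ (_ ∷ [] , _ , s≤s () , _)
  ... | inj₂ (es₁ , es₁⊑ , le₁ , tt)
    with ∃-homogeneous (λ e f → adj? (src e) (tgt f)) (suc c) _ es₁ le₁
  -- An edge with `c` edges before it has a target adjacent to all their sources, so this target is
  -- not small.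
  ... | inj₁ (es₂ , es₂⊑ , c< , st) =
    case split-length c 1 es₂ (≤-trans (≤-reflexive (+-comm c 1)) c<) of λ where
      (fs , e ∷ _ , refl , c≤ , _) →
        let fs-apart , _ = AllPairs-++⁻ fs (AllPairs-resp-⊑ (⊆-trans es₂⊑ es₁⊑) apart)
            _ , fs~e , _ = AllPairs-++⁻ fs st
            e-small      = All.head (All.++⁻ʳ fs (All-resp-⊆ (⊆-trans es₂⊑ es₁⊑) small))
        in ⊥-elim (e-small (map src fs) (AllPairs.map⁺ fs-apart)
             (All.map⁺ (All.map (~-sym ∘ All.head) fs~e))
             (≤-trans c≤ (≤-reflexive (sym (length-map src fs)))))
  ... | inj₂ (es₂ , es₂⊑ , le₂ , st)
    with ∃-homogeneous (λ e f → adj? (tgt e) (src f)) (suc c) k es₂ le₂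
  -- Now it is the first edge whose target sees the sources of `c` later ones.
  ... | inj₁ (e ∷ fs , es₃⊑ , s≤s c≤ , e~fs ∷ _) =
    let s = ⊆-trans es₃⊑ (⊆-trans es₂⊑ es₁⊑) in
    ⊥-elim (All.head (All-resp-⊆ s small) (map src fs)
      (AllPairs.map⁺ (AllPairs.tail (AllPairs-resp-⊑ s apart))) (All.map⁺ e~fs)
      (≤-trans c≤ (≤-reflexive (sym (length-map src fs)))))
  ... | inj₂ (es₃ , es₃⊑ , k≤ , ts) =
    es₃ , s , k≤ , AllPairs.zipWith (λ ((ss , st) , (ts , tt)) → separated ss st ts tt)
      ( AllPairs.zip (AllPairs.map proj₂ (AllPairs-resp-⊑ s apart) , AllPairs-resp-⊑ es₃⊑ st)
      , AllPairs.zip (ts , AllPairs-resp-⊑ (⊆-trans es₃⊑ es₂⊑) tt))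
    where s = ⊆-trans es₃⊑ (⊆-trans es₂⊑ es₁⊑)

  -- Numbering the vertices makes each pair of positions a relation between claws, to which Ramsey's
  -- theorem applies.
  record Claw (c : ℕ) : Set where
    field
      centre : Fin n
      leaf   : Fin c → Fin n
      spoke  : ∀ p → centre ~ leaf p
      apart  : ∀ {p q} → p ≢ q → Apart (leaf p) (leaf q)

    vertex : Fin (suc c) → Fin n
    vertex zero    = centre
    vertex (suc p) = leaf p

  open Claw

  clawOf : ∀ {c v} us → AllPairs Apart us → All (v ~_) us → c ≤ length us →
           ∃[ x ] centre {c} x ≡ v
  clawOf us us-apart v~us c≤ = record
    { leaf  = λ p → lookup us (inject≤ p c≤)
    ; spoke = λ p → All.lookup v~us (∈-lookup (inject≤ p c≤))
    ; apart = λ p≢q → AllPairs-lookup Apart-sym us-apart (p≢q ∘ Fin.inject≤-injective c≤ c≤ _ _)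
    } , refl

  module _ {c : ℕ} where

    -- Distinct claws use distinct leaf positions, so contacts between leaves at equal positions
    -- never matter.
    spokes : List (Claw c) → List (Fin c) → List Edge
    spokes = zipWith (λ x p → mkEdge (spoke x p))

    Touching Avoiding : (p q : Fin (suc c)) → List (Claw c) → Set
    Touching p q = AllPairs (λ x y → vertex x p ~ vertex y q)
    Avoiding p q = AllPairs (λ x y → ¬ vertex x p ~ vertex y q)

    spokes-separated : ∀ xs ps → AllPairs (Apart on centre) xs →
      All (λ p → Avoiding zero (suc p) xs × Avoiding (suc p) zero xs) ps →
      AllPairs (λ p q → Avoiding (suc p) (suc q) xs) ps →
      AllPairs Separated (spokes xs ps)
    spokes-separated []       _        _        _                  _        = []
    spokes-separated (_ ∷ _)  []       _        _                  _        = []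
    spokes-separated (x ∷ xs) (p ∷ ps) (cc ∷ ccs) ((_ , lc ∷ _) ∷ avoid) (ll ∷ lls) =
      All-zipWith⁺ xs ps (All.tabulate λ {y} y∈ → All.tabulate λ {q} q∈ → separated
        (proj₂ (All.lookup cc y∈))
        (All.lookup (AllPairs.head (proj₁ (All.lookup avoid q∈))) y∈)
        (All.lookup lc y∈)
        (All.lookup (AllPairs.head (All.lookup ll q∈)) y∈))
      ∷ spokes-separated xs ps ccs
          (All.map (λ (cl , lc) → AllPairs.tail cl , AllPairs.tail lc) avoid)
          (AllPairs.map AllPairs.tail lls)

    all-leaves-apart : (x : Claw c) {ps : List (Fin c)} → ps ⊑ allFin c →
                       AllPairs Apart (map (leaf x) ps)
    all-leaves-apart x ps⊑ =
      AllPairs.map⁺ (AllPairs.map (apart x) (AllPairs-resp-⊑ ps⊑ (Unique.allFin⁺ c)))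

  module _ (t k : ℕ) (free : BicliqueFree t) where

    private
      at-least : {A B : Set} (f : A → B) (xs : List A) {m : ℕ} → m ≤ length xs → m ≤ length (map f xs)
      at-least f xs m≤ = ≤-trans m≤ (≤-reflexive (sym (length-map f xs)))

      -- The biclique lies between the leaves of the first claw and the centres of all later ones.
      no-leaf-centre : ∀ x y xs ps → AllPairs (Apart on centre) (y ∷ xs) → ps ⊑ allFin (clawSize t k) →
                       All (λ p → Touching (suc p) zero (x ∷ y ∷ xs)) ps →
                       t ≤ length (y ∷ xs) → ¬ t ≤ length ps
      no-leaf-centre x y xs ps ccs ps⊑ touch t≤ t≤ps =
        free (map (leaf x) ps) (map centre (y ∷ xs)) (all-leaves-apart x ps⊑) (AllPairs.map⁺ ccs)
          (All.map⁺ (All.map (All.map⁺ ∘ AllPairs.head) touch))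
          (at-least (leaf x) ps t≤ps) (at-least centre (y ∷ xs) t≤)

      -- The mirror image: leaves of one claw against the centres of the claws before it.
      no-centre-leaf : ∀ xs y ys ps → AllPairs (Apart on centre) xs → ps ⊑ allFin (clawSize t k) →
                       All (λ p → Touching zero (suc p) (xs ++ y ∷ ys)) ps →
                       t ≤ length xs → ¬ t ≤ length ps
      no-centre-leaf xs y ys ps ccs ps⊑ touch t≤ t≤ps =
        free (map (leaf y) ps) (map centre xs) (all-leaves-apart y ps⊑) (AllPairs.map⁺ ccs)
          (All.map⁺ (All.map
            (λ tp → All.map⁺ (All.map (~-sym ∘ All.head) (proj₁ (proj₂ (AllPairs-++⁻ xs tp))))) touch))
          (at-least (leaf y) ps t≤ps) (at-least centre xs t≤)

      -- The first `t` positions taken in `x` and the next `t` taken in `y` span a biclique.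
      no-leaf-leaf : ∀ x y xs ps → ps ⊑ allFin (clawSize t k) →
                     AllPairs (λ p q → Touching (suc p) (suc q) (x ∷ y ∷ xs)) ps →
                     ¬ t + t ≤ length ps
      no-leaf-leaf x y xs ps ps⊑ touch 2t≤ with split-length t t ps 2t≤
      ... | qs , rs , refl , t≤qs , t≤rs =
        let qs-distinct , _ , rs-distinct = AllPairs-++⁻ qs (AllPairs-resp-⊑ ps⊑ (Unique.allFin⁺ _))
            _ , qs~rs , _                 = AllPairs-++⁻ qs touch
        in free (map (leaf x) qs) (map (leaf y) rs)
             (AllPairs.map⁺ (AllPairs.map (apart x) qs-distinct))
             (AllPairs.map⁺ (AllPairs.map (apart y) rs-distinct))
             (All.map⁺ (All.map (All.map⁺ ∘ All.map (All.head ∘ AllPairs.head)) qs~rs))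
             (at-least (leaf x) qs t≤qs) (at-least (leaf y) rs t≤rs)

    -- `P` will be membership in a bag: it passes from the centres to the sources, so the resulting
    -- matching touches that bag.
    ∃-separated-spokes : (P : Pred (Fin n) 0ℓ) (xs : List (Claw (clawSize t k))) →
      AllPairs (Apart on centre) xs → All (P ∘ centre) xs → clawBound t k ≤ length xs →
      ∃[ es ] (k ≤ length es × AllPairs Separated es × All (P ∘ src) es)
    ∃-separated-spokes P xs ccs pcs le
      with ∃-multiHomogeneous {R = λ (p , q) x y → vertex x p ~ vertex y q}
             (λ (p , q) x y → adj? (vertex x p) (vertex y q)) (vertexPairs (clawSize t k)) _ xs le
    ... | _ ∷ [] , _ , s≤s () , _
    ... | zs@(x ∷ y ∷ ys) , zs⊑ , le′@(s≤s le″) , homogeneous =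
      case partition-⊎ t _ classified (≤-reflexive (sym (length-tabulate id))) of λ where
        (inj₁ (ps , ps⊑ , t≤ , touch)) → ⊥-elim
          (no-leaf-centre x y ys ps (AllPairs.tail zcs) ps⊑ touch (≤-trans (m≤n+m t (suc k)) le″) t≤)
        (inj₂ (ps , ps⊑ , le₁ , rest)) → case partition-⊎ t _ rest le₁ of λ where
          (inj₁ (qs , qs⊑ , t≤ , touch)) → ⊥-elim (centre-leaf qs (⊆-trans qs⊑ ps⊑) touch t≤)
          (inj₂ (qs , qs⊑ , r≤ , avoid)) → leaves qs (⊆-trans qs⊑ ps⊑) r≤ avoid
      where
      zcs : AllPairs (Apart on centre) zs
      zcs = AllPairs-resp-⊑ zs⊑ ccs

      homogeneousAt : ∀ p q → Touching p q zs ⊎ Avoiding p q zs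
      homogeneousAt p q = All.lookup homogeneous (∈-cartesianProduct⁺ (∈-allFin p) (∈-allFin q))

      -- The three classes correspond to the three summands of `clawSize t k`, the number of leaf
      -- positions.
      classified : All (λ p → Touching (suc p) zero zs ⊎ Touching zero (suc p) zs ⊎
                              (Avoiding zero (suc p) zs × Avoiding (suc p) zero zs)) (allFin (clawSize t k))
      classified = All.universal (λ p → case homogeneousAt (suc p) zero of λ where
        (inj₁ lc) → inj₁ lc
        (inj₂ lc) → inj₂ (Sum.map₂ (_, lc) (homogeneousAt zero (suc p)))) _

      centre-leaf : ∀ ps → ps ⊑ allFin (clawSize t k) →
                    All (λ p → Touching zero (suc p) zs) ps → ¬ t ≤ length ps
      centre-leaf ps ps⊑ touch
        with split-length t 1 zs (≤-trans (≤-reflexive (+-comm t 1)) (≤-trans (s≤s (m≤n+m t (suc k))) le′))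
      ... | us , v ∷ vs , eq , t≤us , _ =
        no-centre-leaf us v vs ps
          (proj₁ (AllPairs-++⁻ us (subst (AllPairs (Apart on centre)) eq zcs))) ps⊑
          (All.map (subst (Touching zero (suc _)) eq) touch) t≤us

      leaves : ∀ ps → ps ⊑ allFin (clawSize t k) → ramsey (t + t) k ≤ length ps →
               All (λ p → Avoiding zero (suc p) zs × Avoiding (suc p) zero zs) ps →
               ∃[ es ] (k ≤ length es × AllPairs Separated es × All (P ∘ src) es)
      leaves ps ps⊑ r≤ avoid
        -- Ramsey's theorem now acts on leaf positions instead of claws. Since the claws are
        -- homogeneous, a pair of positions that is not `Touching` is `Avoiding`.
        with ∃-homogeneous (λ p q → allPairs? (λ u v → adj? (leaf u p) (leaf v q)) zs) (t + t) k ps r≤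
      ... | inj₁ (qs , qs⊑ , 2t≤ , touch) =
        ⊥-elim (no-leaf-leaf x y ys qs (⊆-trans qs⊑ ps⊑) touch 2t≤)
      ... | inj₂ (qs , qs⊑ , k≤ , ¬touch) =
        spokes zs qs ,
        ≤-trans (⊓-glb (≤-trans (m≤m+n k t) (≤-trans (m≤n+m _ 2) le′)) k≤)
          (≤-reflexive (sym (length-zipWith _ zs qs))) ,
        spokes-separated zs qs zcs (All-resp-⊆ qs⊑ avoid)
          (AllPairs.map (λ {p} {q} ¬t → [ ⊥-elim ∘ ¬t , id ]′ (homogeneousAt (suc p) (suc q))) ¬touch) ,
        All-zipWith⁺ zs qs (All.map (λ pc → All.universal (λ _ → pc) qs) (All-resp-⊆ zs⊑ pcs))

-- Extremal values

-- Without a maximum, every attained value would be exceeded by another; `d` limits how often this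
-- can happen below `b`.
¬¬-maximum : {P : Pred ℕ ℓ} (b : ℕ) → (∀ j → P j → j ≤ b) → ∀ k → P k → ¬ ¬ ∃ (IsMaximum P)
¬¬-maximum {P = P} b bounded k p none = climb (suc b) k p (m≤n+m (suc b) k)
  where
  climb : ∀ d k → P k → ¬ b < k + d
  climb zero    k p b<k+0 = <⇒≱ (subst (b <_) (+-identityʳ k) b<k+0) (bounded k p)
  climb (suc d) k p b<    = none (k , p , λ j q → case j ≤? k of λ where
    (yes j≤k) → j≤k
    (no  j≰k) → contradiction
      (≤-trans b< (≤-trans (≤-reflexive (+-suc k d)) (+-monoˡ-≤ d (≰⇒> j≰k)))) (climb d j q))

¬¬-minimum : {P : Pred ℕ ℓ} → ∀ k → P k → ¬ ¬ ∃ (IsMinimum P)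
¬¬-minimum {P = P} k p none = descend (suc k) k p ≤-refl
  where
  descend : ∀ d k → P k → ¬ k < d
  descend (suc d) k p (s≤s k≤d) = none (k , p , λ j q → case k ≤? j of λ where
    (yes k≤j) → k≤j
    (no  k≰j) → contradiction (≤-trans (≰⇒> k≰j) k≤d) (descend d j q))

module _ {I : Set} (P : I → Pred ℕ 0ℓ) (b : ℕ) (bounded : ∀ i j → P i j → j ≤ b) where

  -- The common shape of `α[ 𝒯 ]≡_` and `μ[ 𝒯 ]≡_`, with the nodes of the tree as indices.
  MaxOfMaxima : Pred ℕ 0ℓ
  MaxOfMaxima = IsMaximum λ k → ∃[ i ] IsMaximum (P i) k

  -- The maximum at `i` is available only under double negation, which suffices for a decidable
  -- inequality.
  ≤-MaxOfMaxima : ∀ {m} → MaxOfMaxima m → ∀ i j → P i j → j ≤ m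
  ≤-MaxOfMaxima {m} (_ , greatest) i j p = decidable-stable (j ≤? m) λ j≰m →
    ¬¬-maximum b (bounded i) j p λ (k , max@(_ , j≤k)) →
    j≰m (≤-trans (j≤k j p) (greatest k (i , max)))

  MaxOfMaxima-≤ : ∀ {m} → MaxOfMaxima m → ∀ l → (∀ i j → P i j → j ≤ l) → m ≤ l
  MaxOfMaxima-≤ ((i , p , _) , _) l below = below i _ p

  ¬¬-MaxOfMaxima : ∀ i j → P i j → ¬ ¬ ∃ MaxOfMaxima
  ¬¬-MaxOfMaxima i j p none = ¬¬-maximum b (bounded i) j p λ (k , max) →
    ¬¬-maximum b (λ { l (i′ , q , _) → bounded i′ l q }) k (i , max) none

-- Subsets as lists

elements : (S : Subset n) → ∃[ xs ] (length xs ≡ ∣ S ∣ × AllPairs _≢_ xs × All (_∈ S) xs)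
elements []            = [] , refl , [] , []
elements (inside ∷ S) with elements S
... | xs , eq , distinct , xs⊆S =
  zero ∷ map suc xs , cong suc (trans (length-map suc xs) eq) ,
  All.map⁺ (All.universal (λ _ ()) xs) ∷ Unique.map⁺ Fin.suc-injective distinct ,
  here ∷ All.map⁺ (All.map there xs⊆S)
elements (outside ∷ S) with elements S
... | xs , eq , distinct , xs⊆S =
  map suc xs , trans (length-map suc xs) eq , Unique.map⁺ Fin.suc-injective distinct ,
  All.map⁺ (All.map there xs⊆S)

∣⁅x⁆∪S∣ : (x : Fin n) (S : Subset n) → x ∉ S → ∣ ⁅ x ⁆ ∪ S ∣ ≡ suc ∣ S ∣
∣⁅x⁆∪S∣ zero    (inside  ∷ S) x∉S = contradiction here x∉S
∣⁅x⁆∪S∣ zero    (outside ∷ S) x∉S = cong (suc ∘ ∣_∣) (Subset.∪-identityˡ S)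
∣⁅x⁆∪S∣ (suc x) (inside  ∷ S) x∉S = cong suc (∣⁅x⁆∪S∣ x S (x∉S ∘ there))
∣⁅x⁆∪S∣ (suc x) (outside ∷ S) x∉S = ∣⁅x⁆∪S∣ x S (x∉S ∘ there)

x∉S-x : (S : Subset n) (x : Fin n) → x ∉ S Subset.- x
x∉S-x (_ ∷ S) (suc x) (there x∈) = x∉S-x S x x∈

fromList : List (Fin n) → Subset n
fromList = foldr (λ x S → ⁅ x ⁆ ∪ S) Subset.⊥

∈-fromList⁻ : ∀ (xs : List (Fin n)) {x} → x ∈ fromList xs → x ∈ˡ xs
∈-fromList⁻ []       x∈ = contradiction x∈ Subset.∉⊥
∈-fromList⁻ (y ∷ xs) x∈ =
  [ here ∘ Subset.x∈⁅y⁆⇒x≡y y , there ∘ ∈-fromList⁻ xs ]′ (Subset.x∈p∪q⁻ ⁅ y ⁆ _ x∈)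

∣fromList∣ : {xs : List (Fin n)} → AllPairs _≢_ xs → ∣ fromList xs ∣ ≡ length xs
∣fromList∣ {n} []                   = Subset.∣⊥∣≡0 n
∣fromList∣ {xs = x ∷ xs} (x≢ ∷ distinct) =
  trans (∣⁅x⁆∪S∣ x _ (λ x∈ → All.lookup x≢ (∈-fromList⁻ xs x∈) refl)) (cong suc (∣fromList∣ distinct))

-- Independent sets and induced matchings at bags, as lists

module _ {G : Graph n} (𝒯 : TreeDecomposition G) where
  open TreeDecomposition 𝒯

  private
    HasIndependent HasMatching : Fin (suc t) → Pred ℕ 0ℓ
    HasIndependent x k = ∃[ S ] (Independent G S × S ⊆ bag x × ∣ S ∣ ≡ k)
    HasMatching    x k = Σ (InducedMatching G k) λ M → Touches M (bag x)

    independent-bounded : ∀ x k → HasIndependent x k → k ≤ n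
    independent-bounded x k (S , _ , _ , refl) = Subset.∣p∣≤n S

    matching-bounded : ∀ x k → HasMatching x k → k ≤ n
    matching-bounded x k (M , _) = Fin.injective⇒≤ {f = left} λ {i} {j} eq →
      decidable-stable (i Fin.≟ j) λ i≢j → disjoint i≢j (inj₁ refl) (inj₁ refl) eq
      where open InducedMatching M

    fromApart : ∀ x us → AllPairs (Apart G) us → All (_∈ bag x) us → HasIndependent x (length us)
    fromApart x us apart us⊆ = fromList us ,
      (λ u v u∈ v∈ u~v → case AllPairs-∈ (Apart-sym G) apart (∈-fromList⁻ us u∈) (∈-fromList⁻ us v∈) of λ where
        (inj₁ refl)      → Graph.irrefl G u~v
        (inj₂ (_ , u≁v)) → u≁v u~v) ,
      (All.lookup us⊆ ∘ ∈-fromList⁻ us) , ∣fromList∣ (AllPairs.map proj₁ apart)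

    toApart : ∀ x k → HasIndependent x k →
              ∃[ us ] (length us ≡ k × AllPairs (Apart G) us × All (_∈ bag x) us)
    toApart x k (S , independent , S⊆ , refl) with elements S
    ... | us , eq , distinct , us⊆ = us , eq , apart us distinct us⊆ , All.map S⊆ us⊆
      where
      apart : ∀ us → AllPairs _≢_ us → All (_∈ S) us → AllPairs (Apart G) us
      apart []       []           []        = []
      apart (u ∷ us) (u≢ ∷ distinct) (u∈ ∷ us∈) =
        All.zipWith (λ (u≢v , v∈) → u≢v , independent _ _ u∈ v∈) (u≢ , us∈) ∷ apart us distinct us∈

  TouchesBag : Fin (suc t) → Pred (Edge G) 0ℓ
  TouchesBag x e = Edge.src e ∈ bag x ⊎ Edge.tgt e ∈ bag x

  private
    fromSeparated : ∀ x es → AllPairs (Separated G) es → All (TouchesBag x) es →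
                    HasMatching x (length es)
    fromSeparated x es sep touch = record
      { left     = Edge.src ∘ lookup es
      ; right    = Edge.tgt ∘ lookup es
      ; edge     = λ i → Edge.src~tgt (lookup es i)
      ; disjoint = λ {i} {j} i≢j → disjoint (lookup es i) (lookup es j)
                                     (AllPairs-lookup (Separated-sym G) sep i≢j)
      ; induced  = λ {i} {j} i≢j → induced (lookup es i) (lookup es j)
                                     (AllPairs-lookup (Separated-sym G) sep i≢j)
      } , λ i → All.lookup touch (∈-lookup i)
      where
      _endOf_ : Fin n → Edge G → Set
      u endOf e = u ≡ Edge.src e ⊎ u ≡ Edge.tgt e
      disjoint : ∀ e f → Separated G e f → ∀ {u v} → u endOf e → v endOf f → u ≢ v
      -- A common end would make one of the two edges run between `e` and `f`.
      disjoint e f (separated ss st ts tt) (inj₁ refl) (inj₁ refl) refl = st (Edge.src~tgt f)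
      disjoint e f (separated ss st ts tt) (inj₁ refl) (inj₂ refl) refl = tt (Graph.sym G (Edge.src~tgt e))
      disjoint e f (separated ss st ts tt) (inj₂ refl) (inj₁ refl) refl = tt (Edge.src~tgt f)
      disjoint e f (separated ss st ts tt) (inj₂ refl) (inj₂ refl) refl = st (Edge.src~tgt e)
      induced : ∀ e f → Separated G e f → ∀ {u v} → u endOf e → v endOf f → ¬ Adj G u v
      induced e f (separated ss st ts tt) (inj₁ refl) (inj₁ refl) = ss
      induced e f (separated ss st ts tt) (inj₁ refl) (inj₂ refl) = st
      induced e f (separated ss st ts tt) (inj₂ refl) (inj₁ refl) = ts
      induced e f (separated ss st ts tt) (inj₂ refl) (inj₂ refl) = tt

  independent≤α : ∀ {a} → α[ 𝒯 ]≡ a → ∀ x us → AllPairs (Apart G) us → All (_∈ bag x) us → length us ≤ a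
  independent≤α α≡a x us apart us⊆ =
    ≤-MaxOfMaxima HasIndependent n independent-bounded α≡a x _ (fromApart x us apart us⊆)

  α≤ : ∀ {a} → α[ 𝒯 ]≡ a → ∀ l →
       (∀ x us → AllPairs (Apart G) us → All (_∈ bag x) us → length us ≤ l) → a ≤ l
  α≤ α≡a l below = MaxOfMaxima-≤ HasIndependent n independent-bounded α≡a l
    λ x k ind → let us , eq , apart , us⊆ = toApart x k ind in
      subst (_≤ l) eq (below x us apart us⊆)

  ¬¬-α : ¬ ¬ ∃ (α[ 𝒯 ]≡_)
  ¬¬-α = ¬¬-MaxOfMaxima HasIndependent n independent-bounded zero _ (fromApart zero [] [] [])

  separated≤μ : ∀ {b} → μ[ 𝒯 ]≡ b → ∀ x es → AllPairs (Separated G) es → All (TouchesBag x) es → length es ≤ b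
  separated≤μ μ≡b x es sep touch =
    ≤-MaxOfMaxima HasMatching n matching-bounded μ≡b x _ (fromSeparated x es sep touch)

  μ≤ : ∀ {b} → μ[ 𝒯 ]≡ b → ∀ l →
       (∀ x k (M : InducedMatching G k) → Touches M (bag x) → k ≤ l) → b ≤ l
  μ≤ μ≡b l below = MaxOfMaxima-≤ HasMatching n matching-bounded μ≡b l λ x k (M , touch) → below x k M touch

  ¬¬-μ : ¬ ¬ ∃ (μ[ 𝒯 ]≡_)
  ¬¬-μ = ¬¬-MaxOfMaxima HasMatching n matching-bounded zero _ (fromSeparated zero [] [] [])

-- Cycles and attached leaves

-- This keeps attached leaves, which have a single neighbour, off every cycle.
twoNeighbours : {G : Graph n} (C : Cycle G) → let open Cycle C in
                ∀ i → ∃[ u ] ∃[ w ] (u ≢ w × Adj G (vertex i) u × Adj G (vertex i) w)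
twoNeighbours {G = G} C = neighbours
  where
  open Cycle C

  vertex≢ : ∀ {i j} → i ≢ j → vertex i ≢ vertex j
  vertex≢ i≢j = i≢j ∘ distinct

  neighbours : ∀ i → ∃[ u ] ∃[ w ] (u ≢ w × Adj G (vertex i) u × Adj G (vertex i) w)
  neighbours zero    = _ , _ , vertex≢ {suc zero} (λ ()) , step zero , Graph.sym G closing
  neighbours (suc i) with view i
  ... | ‵fromℕ     = _ , _ , vertex≢ {inject₁ (fromℕ _)} (λ ()) , Graph.sym G (step (fromℕ _)) , closing
  ... | ‵inject₁ j = _ , _ , vertex≢ j≢2+j , Graph.sym G (step (inject₁ j)) , step (suc j)
    where
    j≢2+j : inject₁ (inject₁ j) ≢ suc (suc j)
    j≢2+j eq = m≢1+n+m (toℕ j) {1} (trans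
      (sym (trans (Fin.toℕ-inject₁ (inject₁ j)) (Fin.toℕ-inject₁ j))) (cong toℕ eq))
splitAt-injective : ∀ l {m} {i j : Fin (l + m)} → splitAt l i ≡ splitAt l j → i ≡ j
splitAt-injective l {m} {i} {j} eq =
  trans (sym (Fin.join-splitAt l m i)) (trans (cong (join l m) eq) (Fin.join-splitAt l m j))

module _ {t : ℕ} (T : Graph (suc t)) {m : ℕ} (host : Fin m → Fin (suc t)) where

  LeafAdj : Rel (Fin (suc t) ⊎ Fin m) 0ℓ
  LeafAdj (inj₁ x) (inj₁ y) = Adj T x y
  LeafAdj (inj₁ x) (inj₂ v) = x ≡ host v
  LeafAdj (inj₂ v) (inj₁ y) = y ≡ host v
  LeafAdj (inj₂ _) (inj₂ _) = ⊥

  LeafAdj-sym : ∀ p q → LeafAdj p q → LeafAdj q p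
  LeafAdj-sym (inj₁ _) (inj₁ _) = Graph.sym T
  LeafAdj-sym (inj₁ _) (inj₂ _) = id
  LeafAdj-sym (inj₂ _) (inj₁ _) = id

  LeafAdj-neighbour : ∀ {v} q → LeafAdj (inj₂ v) q → q ≡ inj₁ (host v)
  LeafAdj-neighbour (inj₁ _) refl = refl

  attachLeaves : Graph (suc t + m)
  attachLeaves = record
    { Adj    = λ p q → LeafAdj (splitAt (suc t) p) (splitAt (suc t) q)
    ; adj?   = λ p q → adj? (splitAt (suc t) p) (splitAt (suc t) q)
    ; sym    = λ {p} {q} → LeafAdj-sym (splitAt (suc t) p) (splitAt (suc t) q)
    ; irrefl = λ {p} → irrefl (splitAt (suc t) p)
    }
    where
    adj? : Decidable LeafAdj
    adj? (inj₁ x) (inj₁ y) = Graph.adj? T x y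
    adj? (inj₁ x) (inj₂ v) = x Fin.≟ host v
    adj? (inj₂ v) (inj₁ y) = y Fin.≟ host v
    adj? (inj₂ _) (inj₂ _) = no λ ()
    irrefl : ∀ p → ¬ LeafAdj p p
    irrefl (inj₁ _) = Graph.irrefl T
    irrefl (inj₂ _) ()

  -- Walks can thus be built on the sum type, where constructors tell old nodes from new leaves.
  attachLeaves-connectedOn : (Y : Pred (Fin (suc t) ⊎ Fin m) 0ℓ) →
    (∀ p q → Y p → Y q → Star (λ r s → LeafAdj r s × Y r × Y s) p q) →
    ConnectedOn attachLeaves (Y ∘ splitAt (suc t))
  attachLeaves-connectedOn Y walk p q yp yq =
    subst₂ (Star _) (Fin.join-splitAt (suc t) m p) (Fin.join-splitAt (suc t) m q)
      (Star.gmap (join (suc t) m) relabel (walk _ _ yp yq))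
    where
    relabel : ∀ {r s} → LeafAdj r s × Y r × Y s →
              let r′ = splitAt (suc t) (join (suc t) m r) ; s′ = splitAt (suc t) (join (suc t) m s)
              in LeafAdj r′ s′ × Y r′ × Y s′
    relabel {r} {s} step rewrite Fin.splitAt-join (suc t) m r | Fin.splitAt-join (suc t) m s = step

  module _ (tree : IsTree T) where
    open IsTree tree

    -- A new leaf on a cycle would have two distinct neighbours, both equal to its host; so every
    -- cycle lies in `T`.
    attachLeaves-isTree : IsTree attachLeaves
    attachLeaves-isTree = record
      { connected = λ p q → Star.map proj₁ (attachLeaves-connectedOn (λ _ → ⊤) walk p q _ _)
      ; acyclic   = λ C → acyclic (restrict C)
      }
      where
      Step : Rel (Fin (suc t) ⊎ Fin m) 0ℓ
      Step r s = LeafAdj r s × ⊤ × ⊤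

      toInner : ∀ p → ∃[ x ] (Star Step p (inj₁ x) × Star Step (inj₁ x) p)
      toInner (inj₁ x) = x , ε , ε
      toInner (inj₂ v) = host v , (refl , _) ◅ ε , (refl , _) ◅ ε

      walk : ∀ p q → ⊤ → ⊤ → Star Step p q
      walk p q _ _ with toInner p | toInner q
      ... | x , p→x , _ | y , _ , y→q = p→x ◅◅ Star.gmap inj₁ (_, _) (connected x y) ◅◅ y→q

      module _ (C : Cycle attachLeaves) where
        open Cycle C

        inner : ∀ i → ∃[ x ] splitAt (suc t) (vertex i) ≡ inj₁ x
        inner i with splitAt (suc t) (vertex i) in eq
        ... | inj₁ x = x , refl
        ... | inj₂ v with twoNeighbours C i
        ... | u , w , u≢w , i~u , i~w =
          contradiction (splitAt-injective (suc t) (trans (to-host u i~u) (sym (to-host w i~w)))) u≢w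
          where
          to-host : ∀ u → Adj attachLeaves (vertex i) u → splitAt (suc t) u ≡ inj₁ (host v)
          to-host u i~u = LeafAdj-neighbour _ (subst (λ p → LeafAdj p (splitAt (suc t) u)) eq i~u)

        restrict : Cycle T
        restrict = record
          { vertex   = proj₁ ∘ inner
          ; distinct = λ {i} {j} e → distinct (trans (sym (Fin.splitAt⁻¹-↑ˡ (proj₂ (inner i))))
                         (trans (cong (_↑ˡ m) e) (Fin.splitAt⁻¹-↑ˡ (proj₂ (inner j)))))
          ; step     = λ i → subst₂ LeafAdj (proj₂ (inner (inject₁ i))) (proj₂ (inner (suc i))) (step i)
          ; closing  = subst₂ LeafAdj (proj₂ (inner (fromℕ _))) (proj₂ (inner zero)) closing
          }

-- Moving an independent set to new leaves

comprehension : {P : Pred (Fin n) 0ℓ} → (∀ u → Dec (P u)) → Subset n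
comprehension P? = Vec.tabulate (λ u → does (P? u))

∈-comprehension⁺ : {P : Pred (Fin n) 0ℓ} (P? : ∀ u → Dec (P u)) → ∀ {u} → P u → u ∈ comprehension P?
∈-comprehension⁺ P? {u} p = Vec.lookup⇒[]= u _ (trans (Vec.lookup∘tabulate _ u) (dec-true (P? u) p))

∈-comprehension⁻ : {P : Pred (Fin n) 0ℓ} (P? : ∀ u → Dec (P u)) → ∀ {u} → u ∈ comprehension P? → P u
∈-comprehension⁻ P? {u} u∈ with P? u | trans (sym (Vec.lookup∘tabulate (does ∘ P?) u)) (Vec.[]=⇒lookup u∈)
... | yes p | _ = p

module _ {G : Graph n} (𝒯 : TreeDecomposition G) {I : Pred (Fin n) 0ℓ} (I? : ∀ u → Dec (I u))
         (I-independent : ∀ {u v} → I u → I v → ¬ Adj G u v) where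
  open TreeDecomposition 𝒯
  open Graph G using (adj?) renaming (Adj to _~_; sym to ~-sym)

  -- Each v in I is moved from the bags of its subtree to a new leaf with bag
  -- N[v]; its neighbours spread over that subtree so as to reach the leaf.
  InBag : Fin (suc t) ⊎ Fin n → Pred (Fin n) 0ℓ
  InBag (inj₁ x) u = (u ∈ bag x × ¬ I u) ⊎ ∃[ v ] (v ∈ bag x × I v × u ~ v)
  InBag (inj₂ v) u = I v × (u ≡ v ⊎ u ~ v)

  inBag? : ∀ p u → Dec (InBag p u)
  inBag? (inj₁ x) u = (u Subset.∈? bag x ×-dec ¬? (I? u)) ⊎-dec
                      Fin.any? (λ v → v Subset.∈? bag x ×-dec I? v ×-dec adj? u v)
  inBag? (inj₂ v) u = I? v ×-dec (u Fin.≟ v ⊎-dec adj? u v)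

  private
    -- For uniformity every vertex gets a leaf, placed at some bag containing it; the leaf of a
    -- vertex outside `I` has an empty bag.
    host : Fin n → Fin (suc t)
    host v = proj₁ (covers-vertices v)

    Within : Fin n → Rel (Fin (suc t) ⊎ Fin n) 0ℓ
    Within u p q = LeafAdj T host p q × InBag p u × InBag q u

    Within-sym : ∀ {u} → Symmetric (Within u)
    Within-sym {u} {p} {q} (pq , p∋u , q∋u) = LeafAdj-sym T host p q pq , q∋u , p∋u

    module _ {u : Fin n} (¬Iu : ¬ I u) where

      -- The new occurrences of `u` follow the subtrees of its neighbours in `I`. Each of these
      -- subtrees meets the old subtree of `u`, in a bag covering the edge `u~v`.
      toBag : ∀ p → InBag p u → ∃[ y ] (u ∈ bag y × Star (Within u) p (inj₁ y))
      toBag-via : ∀ {x v} → v ∈ bag x → I v → u ~ v → ∃[ y ] (u ∈ bag y × Star (Within u) (inj₁ x) (inj₁ y))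
      toBag-via {x} {v} v∈x Iv u~v =
        let y , u∈y , v∈y = covers-edges u v u~v in
        y , u∈y , Star.gmap inj₁ (λ (xy , v∈x , v∈y) →
                    xy , inj₂ (v , v∈x , Iv , u~v) , inj₂ (v , v∈y , Iv , u~v))
                    (coherent v x y v∈x v∈y)
      toBag (inj₁ x) (inj₁ (u∈x , _))            = x , u∈x , ε
      toBag (inj₁ x) (inj₂ (v , v∈x , Iv , u~v)) = toBag-via v∈x Iv u~v
      toBag (inj₂ v) (Iv , inj₁ refl)            = contradiction Iv ¬Iu
      toBag (inj₂ v) (Iv , inj₂ u~v)             =
        let v∈x        = proj₂ (covers-vertices v)
            y , u∈y , w = toBag-via v∈x Iv u~v
        in y , u∈y , (refl , (Iv , inj₂ u~v) , inj₂ (v , v∈x , Iv , u~v)) ◅ w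

    -- As `I` is independent, a vertex of `I` occurs in its own leaf only. Any other vertex walks to
    -- its old subtree, through it, and out again.
    walk : ∀ u p q → InBag p u → InBag q u → Star (Within u) p q
    walk u p q p∋u q∋u with I? u
    ... | yes Iu = subst₂ (Star (Within u)) (sym (only-leaf p p∋u)) (sym (only-leaf q q∋u)) ε
      where
      only-leaf : ∀ p → InBag p u → p ≡ inj₂ u
      only-leaf (inj₁ x) (inj₁ (_ , ¬Iu))           = contradiction Iu ¬Iu
      only-leaf (inj₁ x) (inj₂ (v , _ , Iv , u~v)) = contradiction u~v (I-independent Iu Iv)
      only-leaf (inj₂ v) (Iv , inj₁ refl)          = refl
      only-leaf (inj₂ v) (Iv , inj₂ u~v)           = contradiction u~v (I-independent Iu Iv)
    ... | no ¬Iu =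
      let x , u∈x , p→x = toBag ¬Iu p p∋u
          y , u∈y , q→y = toBag ¬Iu q q∋u
      in p→x ◅◅ Star.gmap inj₁ (λ (xy , u∈x , u∈y) → xy , inj₁ (u∈x , ¬Iu) , inj₁ (u∈y , ¬Iu))
                      (coherent u x y u∈x u∈y)
           ◅◅ Star.reverse Within-sym q→y

    node : Fin (suc t) ⊎ Fin n → Fin (suc t + n)
    node = join (suc t) n

    newBag : Fin (suc t + n) → Subset n
    newBag p = comprehension (inBag? (splitAt (suc t) p))

    ∈-newBag : ∀ p {u} → InBag (splitAt (suc t) p) u → u ∈ newBag p
    ∈-newBag p = ∈-comprehension⁺ (inBag? (splitAt (suc t) p))

    ∈-newBag⁻ : ∀ p {u} → u ∈ newBag p → InBag (splitAt (suc t) p) u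
    ∈-newBag⁻ p = ∈-comprehension⁻ (inBag? (splitAt (suc t) p))

    ∈-newBag⁺ : ∀ p {u} → InBag p u → u ∈ newBag (node p)
    ∈-newBag⁺ p {u} p∋u = ∈-newBag (node p) (subst (λ q → InBag q u) (sym (Fin.splitAt-join (suc t) n p)) p∋u)

  attachNeighbourhoods : TreeDecomposition G
  attachNeighbourhoods = record
    { T               = attachLeaves T host
    ; isTree          = attachLeaves-isTree T host isTree
    ; bag             = newBag
    ; covers-vertices = cover
    ; covers-edges    = coverEdge
    ; coherent        = λ u p q p∋u q∋u →
        Star.map (λ {r} {s} (rs , r∋u , s∋u) → rs , ∈-newBag r r∋u , ∈-newBag s s∋u)
          (attachLeaves-connectedOn T host (λ r → InBag r u) (walk u) p q
            (∈-newBag⁻ p p∋u) (∈-newBag⁻ q q∋u))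
    }
    where
    cover : ∀ u → ∃[ p ] u ∈ newBag p
    cover u with I? u
    ... | yes Iu = node (inj₂ u) , ∈-newBag⁺ (inj₂ u) (Iu , inj₁ refl)
    ... | no ¬Iu = node (inj₁ (host u)) , ∈-newBag⁺ (inj₁ (host u)) (inj₁ (proj₂ (covers-vertices u) , ¬Iu))

    coverEdge : ∀ u v → u ~ v → ∃[ p ] (u ∈ newBag p × v ∈ newBag p)
    coverEdge u v u~v with I? u | I? v
    ... | yes Iu | _ =
      node (inj₂ u) , ∈-newBag⁺ (inj₂ u) (Iu , inj₁ refl) , ∈-newBag⁺ (inj₂ u) (Iu , inj₂ (~-sym u~v))
    ... | no _ | yes Iv =
      node (inj₂ v) , ∈-newBag⁺ (inj₂ v) (Iv , inj₂ u~v) , ∈-newBag⁺ (inj₂ v) (Iv , inj₁ refl)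
    ... | no ¬Iu | no ¬Iv =
      let x , u∈x , v∈x = covers-edges u v u~v in
      node (inj₁ x) , ∈-newBag⁺ (inj₁ x) (inj₁ (u∈x , ¬Iu)) , ∈-newBag⁺ (inj₁ x) (inj₁ (v∈x , ¬Iv))

  attachNeighbourhoods-bag : ∀ p → ∃[ q ] (∀ {u} → u ∈ TreeDecomposition.bag attachNeighbourhoods p → InBag q u)
  attachNeighbourhoods-bag p = splitAt (suc t) p , ∈-newBag⁻ p

-- Bounding tree-α by tree-μ

module _ {G : Graph n} where
  open Graph G using (adj?) renaming (Adj to _~_; sym to ~-sym; irrefl to ~-irrefl)
  open Edge

  separated? : Decidable (Separated G)
  separated? e f = map′
    (λ (ss , st , ts , tt) → separated ss st ts tt) (λ (separated ss st ts tt) → ss , st , ts , tt)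
    (¬? (adj? (src e) (src f)) ×-dec ¬? (adj? (src e) (tgt f)) ×-dec
     ¬? (adj? (tgt e) (src f)) ×-dec ¬? (adj? (tgt e) (tgt f)))

  EndOf : Fin n → Pred (Edge G) 0ℓ
  EndOf u e = u ≡ src e ⊎ u ≡ tgt e

  Near : List (Edge G) → Pred (Fin n) 0ℓ
  Near ms u = Any (λ e → u ~ src e ⊎ u ~ tgt e) ms

  near? : ∀ ms u → Dec (Near ms u)
  near? ms u = Any.any? (λ e → adj? u (src e) ⊎-dec adj? u (tgt e)) ms

  near⇒adjacent : ∀ {ms u} → Near ms u → ∃[ m ] ∃[ v ] (m ∈ˡ ms × EndOf v m × u ~ v)
  near⇒adjacent near with find near
  ... | m , m∈ , inj₁ u~src = m , _ , m∈ , inj₁ refl , u~src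
  ... | m , m∈ , inj₂ u~tgt = m , _ , m∈ , inj₂ refl , u~tgt

  adjacent⇒near : ∀ {ms u m v} → m ∈ˡ ms → EndOf v m → u ~ v → Near ms u
  adjacent⇒near m∈ (inj₁ refl) u~v = lose m∈ (inj₁ u~v)
  adjacent⇒near m∈ (inj₂ refl) u~v = lose m∈ (inj₂ u~v)

  edges-within : {S : Pred (Fin n) 0ℓ} → (∀ u → Dec (S u)) →
    Σ (List (Edge G)) λ es → All (λ e → S (src e) × S (tgt e)) es ×
      (∀ {u v} → S u → S v → u ~ v → ∃[ e ] (e ∈ˡ es × src e ≡ u × tgt e ≡ v))
  edges-within {S} S? =
    let es , ends , within = All-lift (All.map toEdge (All.all-filter joins? pairs)) in
    es , within , λ {u} {v} Su Sv u~v →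
      case ∈-map⁻ (λ e → src e , tgt e) (subst ((u , v) ∈ˡ_) (sym ends)
             (∈-filter⁺ joins? (∈-cartesianProduct⁺ (∈-allFin u) (∈-allFin v)) (u~v , Su , Sv))) of λ where
        (e , e∈ , refl) → e , e∈ , refl , refl
    where
    pairs : List (Fin n × Fin n)
    pairs = cartesianProduct (allFin n) (allFin n)
    joins? : ∀ ((u , v) : Fin n × Fin n) → Dec (u ~ v × S u × S v)
    joins? (u , v) = adj? u v ×-dec S? u ×-dec S? v
    toEdge : ∀ {uv@(u , v) : Fin n × Fin n} → u ~ v × S u × S v →
             Σ (Edge G) λ e → (src e , tgt e) ≡ uv × S (src e) × S (tgt e)
    toEdge (u~v , Su , Sv) = mkEdge u~v , refl , Su , Sv

  -- An edge in `S` with neither end near the matching could be added to it.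
  ∃-maximalMatching : {S : Pred (Fin n) 0ℓ} → (∀ u → Dec (S u)) →
    ∃[ ms ] (AllPairs (Separated G) ms × All (λ e → S (src e) × S (tgt e)) ms ×
             (∀ {u v} → S u → S v → u ~ v → Near ms u ⊎ Near ms v))
  ∃-maximalMatching S? with edges-within S?
  ... | es , within , complete with ∃-maximal (Separated-sym G) separated? es
  ... | ms , ms⊑ , sep , maximal = ms , sep , All-resp-⊆ ms⊑ within , λ Su Sv u~v →
    case complete Su Sv u~v of λ where
      (e , e∈ , refl , refl) → case maximal e∈ of λ where
        -- The ends of a matching edge are near the matching themselves, each being adjacent to its
        -- partner.
        (inj₁ e∈ms) → inj₁ (lose e∈ms (inj₂ u~v))
        (inj₂ ¬sep) → case near? ms (src e) of λ where
          (yes near) → inj₁ near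
          (no ¬near) → inj₂ (decidable-stable (near? ms (tgt e)) λ ¬near′ → ¬sep
            (All.zipWith (λ (¬s , ¬t) → separated (¬s ∘ inj₁) (¬s ∘ inj₂) (¬t ∘ inj₁) (¬t ∘ inj₂))
              (All.¬Any⇒All¬ ms ¬near , All.¬Any⇒All¬ ms ¬near′)))

  module _ {ms : List (Edge G)} (sep : AllPairs (Separated G) ms) where

    matched-adjacent : ∀ {e f u v} → e ∈ˡ ms → f ∈ˡ ms → EndOf u e → EndOf v f → u ~ v → e ≡ f
    matched-adjacent e∈ f∈ ue vf u~v with AllPairs-∈ (Separated-sym G) sep e∈ f∈
    ... | inj₁ e≡f = e≡f
    ... | inj₂ s   = contradiction u~v (apart s ue vf)
      where
      apart : ∀ {e f u v} → Separated G e f → EndOf u e → EndOf v f → ¬ u ~ v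
      apart (separated ss _ _ _) (inj₁ refl) (inj₁ refl) = ss
      apart (separated _ st _ _) (inj₁ refl) (inj₂ refl) = st
      apart (separated _ _ ts _) (inj₂ refl) (inj₁ refl) = ts
      apart (separated _ _ _ tt) (inj₂ refl) (inj₂ refl) = tt

    -- Adjacent ends belong to the same matching edge, and one edge has too few ends for a triangle.
    matched-triangle-free : ∀ {e f g u v w} → e ∈ˡ ms → f ∈ˡ ms → g ∈ˡ ms →
      EndOf u e → EndOf v f → EndOf w g → u ~ v → u ~ w → ¬ v ~ w
    matched-triangle-free {e} e∈ f∈ g∈ ue vf wg u~v u~w v~w
      with matched-adjacent e∈ f∈ ue vf u~v | matched-adjacent e∈ g∈ ue wg u~w
    ... | refl | refl = two-ends ue vf wg u~v u~w v~w
      where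
      two-ends : ∀ {u v w} → EndOf u e → EndOf v e → EndOf w e → u ~ v → u ~ w → ¬ v ~ w
      two-ends (inj₁ refl) (inj₁ refl) _           uv _  _  = ~-irrefl uv
      two-ends (inj₂ refl) (inj₂ refl) _           uv _  _  = ~-irrefl uv
      two-ends (inj₁ refl) (inj₂ _)    (inj₁ refl) _  uw _  = ~-irrefl uw
      two-ends (inj₂ refl) (inj₁ _)    (inj₂ refl) _  uw _  = ~-irrefl uw
      two-ends (inj₁ _)    (inj₂ refl) (inj₂ refl) _  _  vw = ~-irrefl vw
      two-ends (inj₂ _)    (inj₁ refl) (inj₁ refl) _  _  vw = ~-irrefl vw

-- The first two summands bound the old bags, by big vertices and by sources of core edges; the last
-- bounds the new leaves.
treeαBound : ℕ → ℕ → ℕ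
treeαBound t b =
  clawBound t (suc b) + edgeBound (clawSize t (suc b)) (suc b) + suc (clawSize t (suc b))

module _ {G : Graph n} (t b : ℕ) (free : BicliqueFree G t) (𝒯 : TreeDecomposition G) (μ≡b : μ[ 𝒯 ]≡ b) where
  open Graph G using () renaming (Adj to _~_; sym to ~-sym; irrefl to ~-irrefl)
  open TreeDecomposition 𝒯 using (bag)
  open Edge

  private
    c : ℕ
    c = clawSize t (suc b)

    Big : Pred (Fin n) 0ℓ
    Big u = ∃[ x ] Claw.centre {G = G} {c} x ≡ u

    ¬big⇒small : ∀ {u} → ¬ Big u → SmallStar G c u
    ¬big⇒small ¬big us apart u~us c≤ = ¬big (clawOf G us apart u~us c≤)

    big-bounded : ∀ x us → AllPairs (Apart G) us → All (λ u → u ∈ bag x × Big u) us →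
                  ¬ clawBound t (suc b) ≤ length us
    big-bounded x us apart big le with All-lift {P = λ y → Claw.centre y ∈ bag x}
                                          (All.map (λ { (u∈x , y , refl) → y , refl , u∈x }) big)
    ... | xs , refl , xs∈x =
      let es , b< , sep , touch = ∃-separated-spokes G t (suc b) free (_∈ bag x) xs
            (AllPairs.map⁻ apart) xs∈x (≤-trans le (≤-reflexive (length-map _ xs)))
      in <⇒≱ b< (separated≤μ 𝒯 μ≡b x es sep (All.map inj₁ touch))

  module _ (big? : ∀ u → Dec (Big u)) {ms : List (Edge G)} (sep : AllPairs (Separated G) ms)
           (ms-small : All (λ e → ¬ Big (src e) × ¬ Big (tgt e)) ms)
           (maximal : ∀ {u v} → ¬ Big u → ¬ Big v → u ~ v → Near ms u ⊎ Near ms v) where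

    -- These are the vertices moved to new leaves. Matched vertices are not among them, being near
    -- their partners.
    Isolated : Pred (Fin n) 0ℓ
    Isolated u = ¬ Big u × ¬ Near ms u

    isolated-independent : ∀ {u v} → Isolated u → Isolated v → ¬ u ~ v
    isolated-independent (¬big , ¬near) (¬big′ , ¬near′) u~v =
      [ ¬near , ¬near′ ]′ (maximal ¬big ¬big′ u~v)

    refined : TreeDecomposition G
    refined = attachNeighbourhoods 𝒯 (λ u → ¬? (big? u) ×-dec ¬? (near? ms u)) isolated-independent

    -- The only edges among core vertices are those of the matching `ms`.
    Core : Pred (Fin n) 0ℓ
    Core u = Isolated u ⊎ ∃[ m ] (m ∈ˡ ms × EndOf u m)

    core-small : ∀ {u} → Core u → SmallStar G c u
    core-small (inj₁ (¬big , _))            = ¬big⇒small ¬big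
    core-small (inj₂ (m , m∈ , inj₁ refl)) = ¬big⇒small (proj₁ (All.lookup ms-small m∈))
    core-small (inj₂ (m , m∈ , inj₂ refl)) = ¬big⇒small (proj₂ (All.lookup ms-small m∈))

    isolated-core : ∀ {u v} → Isolated u → Core v → ¬ u ~ v
    isolated-core iso         (inj₁ iso′)         = isolated-independent iso iso′
    isolated-core (_ , ¬near) (inj₂ (m , m∈ , v∈)) = ¬near ∘ adjacent⇒near m∈ v∈

    core-triangle-free : ∀ {u v w} → Core u → Core v → Core w → u ~ v → u ~ w → ¬ v ~ w
    core-triangle-free (inj₁ iso) cv         _          uv _  _  = isolated-core iso cv uv
    core-triangle-free cu@(inj₂ _) (inj₁ iso) _         uv _  _  = isolated-core iso cu (~-sym uv)
    core-triangle-free cu@(inj₂ _) (inj₂ _) (inj₁ iso)  _  uw _  = isolated-core iso cu (~-sym uw)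
    core-triangle-free (inj₂ (_ , e∈ , ue)) (inj₂ (_ , f∈ , vf)) (inj₂ (_ , g∈ , wg)) =
      matched-triangle-free sep e∈ f∈ g∈ ue vf wg

    -- Either end may meet the old bag: the source if `u` was there before, the target if `u` was
    -- added as a neighbour of an isolated vertex.
    CoreEdge : ∀ x → Pred (Fin n) 0ℓ
    CoreEdge x u = ∃[ e ] (src e ≡ u × TouchesBag 𝒯 x e × Core (tgt e))

    core-bounded : ∀ x us → AllPairs (Apart G) us → All (CoreEdge x) us → ¬ edgeBound c (suc b) ≤ length us
    core-bounded x us apart core-edges le with All-lift core-edges
    ... | es , refl , touch-core =
      let fs , fs⊑ , b< , fs-sep = ∃-separated-edges G c (suc b) es (AllPairs.map⁻ apart)
            (All.map (core-small ∘ proj₂) touch-core)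
            (λ e∈ f∈ g∈ → core-triangle-free (core e∈) (core f∈) (core g∈))
            (≤-trans le (≤-reflexive (length-map src es)))
      in <⇒≱ b< (separated≤μ 𝒯 μ≡b x fs fs-sep (All-resp-⊆ fs⊑ (All.map proj₁ touch-core)))
      where
      core : ∀ {e} → e ∈ˡ es → Core (tgt e)
      core e∈ = proj₂ (All.lookup touch-core e∈)

    star-bounded : ∀ v us → AllPairs (Apart G) us → All (λ u → Isolated v × (u ≡ v ⊎ u ~ v)) us →
                   length us ≤ suc c
    star-bounded v []      _                   _                        = z≤n
    -- The bound `suc c` admits this singleton without knowing that `c` is positive.
    star-bounded v (u ∷ []) _                  ((_ , inj₁ refl) ∷ _)    = s≤s z≤n
    -- The vertex `v` is adjacent to the rest of its bag, so it shares no independent set with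
    -- another vertex there.
    star-bounded v (u ∷ w ∷ _) ((u#w ∷ _) ∷ _) ((_ , inj₁ refl) ∷ (_ , near) ∷ _) =
      ⊥-elim ([ proj₁ u#w ∘ sym , proj₂ u#w ∘ ~-sym ]′ near)
    star-bounded v us@(_ ∷ _) apart@(u# ∷ _)   ((iso , inj₂ u~v) ∷ near) =
      m≤n⇒m≤1+n (<⇒≤ (≰⇒> (core-small (inj₁ iso) us apart (~-sym u~v ∷ All.zipWith
        (λ { ((_ , u≁w) , (_ , inj₁ refl)) → contradiction u~v u≁w
           ; (_         , (_ , inj₂ w~v))  → ~-sym w~v }) (u# , near)))))

    refined-bounded : ∀ p us → AllPairs (Apart G) us →
                      All (_∈ TreeDecomposition.bag refined p) us → length us ≤ treeαBound t b
    refined-bounded p us apart us⊆ with attachNeighbourhoods-bag 𝒯 _ isolated-independent p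
    ... | inj₂ v , inBag = ≤-trans (star-bounded v us apart (All.map inBag us⊆)) (m≤n+m _ _)
    ... | inj₁ x , inBag = ≤-trans (<⇒≤ (≰⇒> λ le → case partition-⊎ _ _ (All.map classify us⊆) le of λ where
        (inj₁ (vs , vs⊑ , le₁ , big))  → big-bounded x vs (AllPairs-resp-⊑ vs⊑ apart) big le₁
        (inj₂ (vs , vs⊑ , le₂ , core)) → core-bounded x vs (AllPairs-resp-⊑ vs⊑ apart) core le₂)) (m≤m+n _ _)
      where
      classify : ∀ {u} → u ∈ TreeDecomposition.bag refined p → (u ∈ bag x × Big u) ⊎ CoreEdge x u
      classify {u} u∈p with inBag u∈p
      ... | inj₂ (v , v∈x , iso , u~v) = inj₂ (mkEdge u~v , refl , inj₂ v∈x , inj₁ iso)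
      ... | inj₁ (u∈x , ¬iso) with big? u
      ... | yes big = inj₁ (u∈x , big)
      ... | no ¬big =
        let m , v , m∈ , v∈m , u~v = near⇒adjacent (decidable-stable (near? ms u) λ ¬near → ¬iso (¬big , ¬near))
        in inj₂ (mkEdge u~v , refl , inj₁ u∈x , inj₂ (m , m∈ , v∈m))

tree-α≤treeαBound : {G : Graph (suc n)} → ∀ t {a b} → BicliqueFree G t → tree-α G a → tree-μ G b →
                    a ≤ treeαBound t b
tree-α≤treeαBound t {a} {b} free (_ , least) ((𝒯 , μ≡b) , _) =
  decidable-stable (a ≤? treeαBound t b) λ a≰ →
  -- Double negation commutes with finite products, so bigness may be decided for all vertices at
  -- once.
  Fin.sequence (RawMonad.rawApplicative ¬¬-Monad) (λ u → ¬¬-excluded-middle) λ big? →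
  let ms , sep , small , maximal = ∃-maximalMatching (λ u → ¬? (big? u))
      𝒯′ = refined t b free 𝒯 μ≡b big? sep small maximal
  in ¬¬-α 𝒯′ λ (a′ , α≡a′) → a≰ (≤-trans (least a′ (𝒯′ , α≡a′))
    (α≤ 𝒯′ α≡a′ _ (refined-bounded t b free 𝒯 μ≡b big? sep small maximal)))

-- One end in the bag, chosen from each edge of a touching induced matching, gives an independent
-- set. The same decomposition therefore serves for both parameters.
tree-μ≤tree-α : {G : Graph (suc n)} → ∀ {a b} → tree-μ G b → tree-α G a → b ≤ a
tree-μ≤tree-α {a = a} {b} (_ , least) ((𝒯 , α≡a) , _) =
  decidable-stable (b ≤? a) λ b≰ →
  ¬¬-μ 𝒯 λ (b′ , μ≡b′) → b≰ (≤-trans (least b′ (𝒯 , μ≡b′)) (μ≤ 𝒯 μ≡b′ a touching≤))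
  where
  touching≤ : ∀ x k (M : InducedMatching _ k) → Touches M (TreeDecomposition.bag 𝒯 x) → k ≤ a
  touching≤ x k M touch = ≤-trans (≤-reflexive (sym (length-tabulate touched)))
    (independent≤α 𝒯 α≡a x (tabulate touched)
      (AllPairs.tabulate⁺ λ {i} {j} i≢j →
        disjoint i≢j (touched-end i) (touched-end j) , induced i≢j (touched-end i) (touched-end j))
      (All.tabulate⁺ touched∈))
    where
    open InducedMatching M
    touched : Fin k → Fin _
    touched i = [ (λ _ → left i) , (λ _ → right i) ]′ (touch i)
    touched-end : ∀ i → touched i endOf i
    touched-end i with touch i
    ... | inj₁ _ = inj₁ refl
    ... | inj₂ _ = inj₂ refl
    touched∈ : ∀ i → touched i ∈ TreeDecomposition.bag 𝒯 x
    touched∈ i with touch i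
    ... | inj₁ left∈  = left∈
    ... | inj₂ right∈ = right∈

-- Induced subgraphs and bicliques

module _ {ℓ} (𝒢 : GraphClass ℓ) (hereditary : Hereditary 𝒢) where

  -- Vertices missed by `ι` are deleted one at a time; once none is missed, `ι` is an isomorphism.
  member-induced : ∀ {k n} {H : Graph (suc k)} {G : Graph (suc n)} → Member 𝒢 G →
    (ι : Fin (suc k) → Fin (suc n)) → Injective _≡_ _≡_ ι →
    (∀ u v → Adj H u v ⇔ Adj G (ι u) (ι v)) → Member 𝒢 H
  member-induced {k} {n} {H} {G} G∈ ι ι-injective ι-adj
    with Fin.any? (λ v → Fin.all? (λ i → ¬? (v Fin.≟ ι i)))
  ... | no onto = GraphClass.iso-closed 𝒢 iso G∈
    where
    preimage : ∀ v → ∃[ i ] v ≡ ι i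
    preimage v with Fin.any? (λ i → v Fin.≟ ι i)
    ... | yes found = found
    ... | no  none  = contradiction (v , λ i v≡ιi → none (i , v≡ιi)) onto
    ι⁻¹ : Fin (suc n) → Fin (suc k)
    ι⁻¹ = proj₁ ∘ preimage
    ι∘ι⁻¹ : ∀ v → ι (ι⁻¹ v) ≡ v
    ι∘ι⁻¹ v = sym (proj₂ (preimage v))
    iso : G ≅ H
    iso = record
      { bijection = mk↔ₛ′ ι⁻¹ ι (λ i → ι-injective (ι∘ι⁻¹ (ι i))) ι∘ι⁻¹
      ; preserves = λ u v → mk⇔
          (Equivalence.from (ι-adj _ _) ∘ subst₂ (Adj G) (sym (ι∘ι⁻¹ u)) (sym (ι∘ι⁻¹ v)))
          (subst₂ (Adj G) (ι∘ι⁻¹ u) (ι∘ι⁻¹ v) ∘ Equivalence.to (ι-adj _ _))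
      }
  member-induced {n = zero}  G∈ ι _ _ | yes (zero , missed) with ι zero | missed zero
  ... | zero | 0≢0 = contradiction refl 0≢0
  member-induced {n = suc n} {H} {G} G∈ ι ι-injective ι-adj | yes (v , missed) =
    member-induced {H = H} (hereditary G v G∈) (λ i → punchOut (missed i))
      (λ {i} {j} → ι-injective ∘ Fin.punchOut-injective (missed i) (missed j))
      λ i j → subst₂ (λ u w → Adj H i j ⇔ Adj G u w)
        (sym (Fin.punchIn-punchOut (missed i))) (sym (Fin.punchIn-punchOut (missed j))) (ι-adj i j)

  -- The sum of the two side lengths is a common upper bound for them, so a balanced biclique of
  -- that size contains the omitted one.
  omitted⇒bicliqueFree : ∀ {l m} → ¬ Member 𝒢 K[ suc l , suc m ] →
    ∀ {n} {G : Graph (suc n)} → Member 𝒢 G → BicliqueFree G (suc l + suc m)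
  omitted⇒bicliqueFree {l} {m} K∉ {n} {G} G∈ us vs us-apart vs-apart us~vs us-long vs-long =
    K∉ (member-induced {H = K[ suc l , suc m ]} G∈ (place ∘ splitAt (suc l))
      (λ {i} {j} → splitAt-injective (suc l) ∘ place-injective (splitAt (suc l) i) (splitAt (suc l) j))
      (λ i j → mk⇔ (place-adj (splitAt (suc l) i) (splitAt (suc l) j))
                   (place-adj⁻ (splitAt (suc l) i) (splitAt (suc l) j))))
    where
    l≤ : suc l ≤ length us
    l≤ = ≤-trans (m≤m+n (suc l) (suc m)) us-long
    m≤ : suc m ≤ length vs
    m≤ = ≤-trans (m≤n+m (suc m) (suc l)) vs-long

    place : Fin (suc l) ⊎ Fin (suc m) → Fin (suc n)
    place (inj₁ i) = lookup us (inject≤ i l≤)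
    place (inj₂ j) = lookup vs (inject≤ j m≤)

    cross : ∀ i j → Adj G (place (inj₁ i)) (place (inj₂ j))
    cross i j = All.lookup (All.lookup us~vs (∈-lookup (inject≤ i l≤))) (∈-lookup (inject≤ j m≤))

    us-apart′ : ∀ {i j} → i ≢ j → Apart G (place (inj₁ i)) (place (inj₁ j))
    us-apart′ i≢j = AllPairs-lookup (Apart-sym G) us-apart (i≢j ∘ Fin.inject≤-injective l≤ l≤ _ _)

    vs-apart′ : ∀ {i j} → i ≢ j → Apart G (place (inj₂ i)) (place (inj₂ j))
    vs-apart′ i≢j = AllPairs-lookup (Apart-sym G) vs-apart (i≢j ∘ Fin.inject≤-injective m≤ m≤ _ _)

    place-injective : ∀ p q → place p ≡ place q → p ≡ q
    place-injective (inj₁ i) (inj₁ j) eq = cong inj₁ (decidable-stable (i Fin.≟ j)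
      λ i≢j → proj₁ (us-apart′ i≢j) eq)
    place-injective (inj₁ i) (inj₂ j) eq = contradiction (subst (Adj G _) (sym eq) (cross i j)) (Graph.irrefl G)
    place-injective (inj₂ j) (inj₁ i) eq = contradiction (subst (Adj G _) eq (cross i j)) (Graph.irrefl G)
    place-injective (inj₂ i) (inj₂ j) eq = cong inj₂ (decidable-stable (i Fin.≟ j)
      λ i≢j → proj₁ (vs-apart′ i≢j) eq)

    place-adj : ∀ p q → OppositeSides p q → Adj G (place p) (place q)
    place-adj (inj₁ i) (inj₂ j) _ = cross i j
    place-adj (inj₂ j) (inj₁ i) _ = Graph.sym G (cross i j)

    place-adj⁻ : ∀ p q → Adj G (place p) (place q) → OppositeSides p q
    place-adj⁻ (inj₁ i) (inj₁ j) i~j with i Fin.≟ j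
    ... | yes refl = Graph.irrefl G i~j
    ... | no  i≢j  = proj₂ (us-apart′ i≢j) i~j
    place-adj⁻ (inj₁ i) (inj₂ j) _   = _
    place-adj⁻ (inj₂ i) (inj₁ j) _   = _
    place-adj⁻ (inj₂ i) (inj₂ j) i~j with i Fin.≟ j
    ... | yes refl = Graph.irrefl G i~j
    ... | no  i≢j  = proj₂ (vs-apart′ i≢j) i~j

-- Every tree decomposition has a bag containing a closed neighbourhood

module _ {T : Graph n} (acyclic : ¬ Cycle T) (A : Subset n) where

  record Path (m : ℕ) : Set where
    field
      vertex   : Fin (2 + m) → Fin n
      distinct : Injective _≡_ _≡_ vertex
      step     : ∀ i → Adj T (vertex (inject₁ i)) (vertex (suc i))
      within   : ∀ i → vertex i ∈ A

  -- If `x` has no neighbour in `A`, any `y` will do, even `x` itself or a node outside `A`.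
  Leaf : Set
  Leaf = ∃[ x ] (x ∈ A × ∃[ y ] (∀ z → z ∈ A → Adj T x z → z ≡ y))

  -- A chord at the first vertex would close an initial segment to a cycle. Hence any neighbour
  -- other than the second vertex extends the path.
  chord-free : ∀ {m} (P : Path m) → let open Path P in ∀ i → Adj T (vertex zero) (vertex i) → i ≡ suc zero
  chord-free P zero          adj = contradiction adj (Graph.irrefl T)
  chord-free P (suc zero)    _   = refl
  chord-free {m} P (suc (suc j)) adj = contradiction cycle acyclic
    where
    open Path P
    k<m : 2 + toℕ j ≤ 1 + m
    k<m = Fin.toℕ<n (suc j)
    cycle : Cycle T
    cycle = record
      { vertex   = λ i → vertex (inject≤ i (s≤s k<m))
      ; distinct = λ eq → Fin.inject≤-injective (s≤s k<m) (s≤s k<m) _ _ (distinct eq)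
      ; step     = λ i → subst (λ l → Adj T (vertex l) (vertex (suc (inject≤ i k<m))))
          (Fin.toℕ-injective (trans (Fin.toℕ-inject₁ _) (trans (Fin.toℕ-inject≤ i k<m)
            (sym (trans (Fin.toℕ-inject≤ (inject₁ i) (s≤s k<m)) (Fin.toℕ-inject₁ i))))))
          (step (inject≤ i k<m))
      ; closing  = subst (λ l → Adj T (vertex l) (vertex zero))
          (Fin.toℕ-injective (sym (trans (Fin.toℕ-inject≤ (fromℕ (2 + toℕ j)) (s≤s k<m)) (Fin.toℕ-fromℕ _))))
          (Graph.sym T adj)
      }

  extend : ∀ {m} (P : Path m) → let open Path P in ∀ z → z ∈ A → Adj T (vertex zero) z →
           z ≢ vertex (suc zero) → Path (suc m)
  extend {m} P z z∈A x~z z≢y = record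
    { vertex   = z∷vertex
    ; distinct = z∷distinct _ _
    ; step     = λ where
        zero    → Graph.sym T x~z
        (suc i) → step i
    ; within   = λ where
        zero    → z∈A
        (suc i) → within i
    }
    where
    open Path P
    fresh : ∀ i → z ≢ vertex i
    fresh i refl with chord-free P i x~z
    ... | refl = z≢y refl
    z∷vertex : Fin (3 + m) → Fin n
    z∷vertex zero    = z
    z∷vertex (suc i) = vertex i
    z∷distinct : ∀ i j → z∷vertex i ≡ z∷vertex j → i ≡ j
    z∷distinct zero    zero    _  = refl
    z∷distinct zero    (suc j) eq = contradiction eq (fresh j)
    z∷distinct (suc i) zero    eq = contradiction (sym eq) (fresh i)
    z∷distinct (suc i) (suc j) eq = cong suc (distinct eq)

  -- The path is extended at its front until it gets stuck at a leaf; `d` bounds the extensions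
  -- left, as its `2 + m` vertices are distinct.
  leaf-beyond : ∀ d {m} → n ≤ d + m → Path m → Leaf
  leaf-beyond zero    n≤m P =
    contradiction (≤-trans (Fin.injective⇒≤ (Path.distinct P)) n≤m) (<⇒≱ (s≤s (n≤1+n _)))
  leaf-beyond (suc d) {m} n≤ P
    with Fin.any? (λ z → z Subset.∈? A ×-dec Graph.adj? T (vertex zero) z ×-dec ¬? (z Fin.≟ vertex (suc zero)))
    where open Path P
  ... | yes (z , z∈A , x~z , z≢y) =
    leaf-beyond d (≤-trans n≤ (≤-reflexive (sym (+-suc d m)))) (extend P z z∈A x~z z≢y)
  ... | no none = vertex zero , within zero , vertex (suc zero) , λ z z∈A x~z →
    decidable-stable (z Fin.≟ vertex (suc zero)) λ z≢y → none (z , z∈A , x~z , z≢y)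
    where open Path P

  ∃-leaf : ∀ {x} → x ∈ A → Leaf
  ∃-leaf {x} x∈A with Fin.any? (λ z → z Subset.∈? A ×-dec Graph.adj? T x z)
  ... | no none = x , x∈A , x , λ z z∈A x~z → contradiction (z , z∈A , x~z) none
  ... | yes (z , z∈A , x~z) = leaf-beyond n (m≤m+n n 0) record
    { vertex   = xz
    ; distinct = xz-distinct _ _
    ; step     = λ { zero → x~z }
    ; within   = λ { zero → x∈A ; (suc zero) → z∈A }
    }
    where
    xz : Fin 2 → Fin n
    xz zero       = x
    xz (suc zero) = z
    xz-distinct : ∀ i j → xz i ≡ xz j → i ≡ j
    xz-distinct zero       zero       _    = refl
    xz-distinct zero       (suc zero) refl = contradiction x~z (Graph.irrefl T)
    xz-distinct (suc zero) zero       refl = contradiction x~z (Graph.irrefl T)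
    xz-distinct (suc zero) (suc zero) _    = refl

module _ {G : Graph (suc n)} (𝒯 : TreeDecomposition G) where
  open TreeDecomposition 𝒯
  open IsTree isTree

  -- Peel off the tree leaf by leaf: a bag at a leaf is either absorbed by its
  -- neighbour or has a private vertex, all of whose neighbours it must contain.
  record Suffices (A : Subset (suc t)) : Set where
    field
      vertices : ∀ v → ∃[ x ] (x ∈ A × v ∈ bag x)
      edges    : ∀ u v → Adj G u v → ∃[ x ] (x ∈ A × u ∈ bag x × v ∈ bag x)
      connects : ∀ v → ConnectedOn T (λ x → x ∈ A × v ∈ bag x)

  ContainsNeighbourhood : Set
  ContainsNeighbourhood = ∃[ x ] ∃[ v ] (∀ u → Adj G v u → u ∈ bag x)

  module _ {A : Subset (suc t)} (suffices : Suffices A) {x y : Fin (suc t)} (x∈A : x ∈ A)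
           (x-leaf : ∀ z → z ∈ A → Adj T x z → z ≡ y) where
    open Suffices suffices

    -- The first two conditions exclude the degenerate `y` of an isolated node.
    Absorbed : Pred (Fin (suc n)) 0ℓ
    Absorbed v = x ≢ y × y ∈ A × v ∈ bag y

    -- A walk leaving `x` within the bags of `v` would have to enter `y`. So `x` is the only
    -- remaining node whose bag contains `v`, and it covers all edges at `v`.
    private-vertex : ∀ {v} → v ∈ bag x → ¬ Absorbed v → ContainsNeighbourhood
    private-vertex {v} v∈x ¬absorbed = x , v , λ u v~u →
      let z , z∈A , v∈z , u∈z = edges v u v~u in
      subst (λ w → u ∈ bag w) (sym (only-x (connects v x z (x∈A , v∈x) (z∈A , v∈z)))) u∈z
      where
      only-x : ∀ {z} → Star (λ p q → Adj T p q × (p ∈ A × v ∈ bag p) × (q ∈ A × v ∈ bag q)) x z → x ≡ z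
      only-x ε = refl
      only-x ((x~z , _ , z∈A , v∈z) ◅ _) with x-leaf _ z∈A x~z
      ... | refl = contradiction ((λ { refl → Graph.irrefl T x~z }) , z∈A , v∈z) ¬absorbed

    module _ (absorbed : ∀ {v} → v ∈ bag x → Absorbed v) where

      drop-leaf : Suffices (A Subset.- x)
      drop-leaf = record
        { vertices = λ v → let z , z∈A , v∈z = vertices v in move z , move-∈ z∈A v∈z
        ; edges    = λ u v u~v → let z , z∈A , u∈z , v∈z = edges u v u~v in
            move z , proj₁ (move-∈ z∈A u∈z) , proj₂ (move-∈ z∈A u∈z) , proj₂ (move-∈ z∈A v∈z)
        ; connects = λ v p q (p∈ , v∈p) (q∈ , v∈q) →
            subst₂ (Star (Within v)) (move-fixed p∈) (move-fixed q∈)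
              (Star.kleisliStar move move-step (connects v p q (∈A p∈ , v∈p) (∈A q∈ , v∈q)))
        }
        where
        Within : Fin (suc n) → Rel (Fin (suc t)) 0ℓ
        Within v p q = Adj T p q × (p ∈ A Subset.- x × v ∈ bag p) × (q ∈ A Subset.- x × v ∈ bag q)

        -- A retraction onto the remaining nodes: the bag at `y` contains the one at `x`.
        move : Fin (suc t) → Fin (suc t)
        move z with z Fin.≟ x
        ... | yes _ = y
        ... | no  _ = z

        move-∈ : ∀ {z v} → z ∈ A → v ∈ bag z → move z ∈ A Subset.- x × v ∈ bag (move z)
        move-∈ {z} z∈A v∈z with z Fin.≟ x
        ... | no z≢x   = Subset.x∈p∧x≢y⇒x∈p-y z∈A z≢x , v∈z
        ... | yes refl = let x≢y , y∈A , v∈y = absorbed v∈z in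
                         Subset.x∈p∧x≢y⇒x∈p-y y∈A (x≢y ∘ sym) , v∈y

        ∈A : ∀ {z} → z ∈ A Subset.- x → z ∈ A
        ∈A = Subset.p─q⊆p A ⁅ x ⁆

        move-fixed : ∀ {z} → z ∈ A Subset.- x → move z ≡ z
        move-fixed {z} z∈ with z Fin.≟ x
        ... | no _     = refl
        ... | yes refl = contradiction z∈ (x∉S-x A x)

        move-step : ∀ {v p q} → Adj T p q × (p ∈ A × v ∈ bag p) × (q ∈ A × v ∈ bag q) →
                    Star (Within v) (move p) (move q)
        move-step {v} {p} {q} (p~q , (p∈A , v∈p) , (q∈A , v∈q)) with move-∈ p∈A v∈p | move-∈ q∈A v∈q
        ... | p∈ | q∈ with p Fin.≟ x | q Fin.≟ x
        ... | yes refl | yes refl = ε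
        -- A step between `x` and another node collapses, since that node is `y`.
        ... | yes refl | no _     = subst (Star (Within v) y) (sym (x-leaf q q∈A p~q)) ε
        ... | no _     | yes refl = subst (λ z → Star (Within v) z y) (sym (x-leaf p p∈A (Graph.sym T p~q))) ε
        ... | no _     | no _     = (p~q , p∈ , q∈) ◅ ε

  peel : ∀ d A → ∣ A ∣ < d → Suffices A → ContainsNeighbourhood
  peel (suc d) A (s≤s ∣A∣≤d) suffices
    -- Some remaining bag contains the vertex `zero`, so `A` never becomes empty and the peeling
    -- must end with a private vertex.
    with ∃-leaf acyclic A (proj₁ (proj₂ (Suffices.vertices suffices zero)))
  ... | x , x∈A , y , x-leaf
    with Fin.any? (λ v → v Subset.∈? bag x ×-dec
                         ¬? (¬? (x Fin.≟ y) ×-dec y Subset.∈? A ×-dec v Subset.∈? bag y))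
  ... | yes (v , v∈x , ¬absorbed) = private-vertex suffices x∈A x-leaf v∈x ¬absorbed
  ... | no all-absorbed = peel d (A Subset.- x) (≤-trans (Subset.x∈p⇒∣p-x∣<∣p∣ x∈A) ∣A∣≤d)
    (drop-leaf suffices x∈A x-leaf λ {v} v∈x →
      decidable-stable (¬? (x Fin.≟ y) ×-dec y Subset.∈? A ×-dec v Subset.∈? bag y)
        λ ¬absorbed → all-absorbed (v , v∈x , ¬absorbed))

  ∃-neighbourhood-bag : ContainsNeighbourhood
  ∃-neighbourhood-bag = peel _ Subset.⊤ ≤-refl record
    { vertices = λ v → let x , v∈x = covers-vertices v in x , Subset.∈⊤ , v∈x
    ; edges    = λ u v u~v → let x , uv∈x = covers-edges u v u~v in x , Subset.∈⊤ , uv∈x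
    ; connects = λ v x y (_ , v∈x) (_ , v∈y) →
        Star.map (λ (xy , v∈x , v∈y) → xy , (Subset.∈⊤ , v∈x) , (Subset.∈⊤ , v∈y)) (coherent v x y v∈x v∈y)
    }

-- Parameters of complete bipartite graphs

oneBag : (G : Graph n) → TreeDecomposition G
oneBag G = record
  { t               = 0
  ; T               = record { Adj = λ _ _ → ⊥ ; adj? = λ _ _ → no id ; sym = id ; irrefl = id }
  ; isTree          = record { connected = λ { zero zero → ε } ; acyclic = Cycle.closing }
  ; bag             = λ _ → Subset.⊤
  ; covers-vertices = λ _ → zero , Subset.∈⊤
  ; covers-edges    = λ _ _ _ → zero , Subset.∈⊤ , Subset.∈⊤
  ; coherent        = λ { _ zero zero _ _ → ε }
  }

-- The neighbourhood found in a bag is a whole side of the biclique.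
biclique-α≥ : ∀ m (𝒯 : TreeDecomposition K[ suc m , suc m ]) → ∀ {a} → α[ 𝒯 ]≡ a → suc m ≤ a
biclique-α≥ m 𝒯 {a} α≡a with ∃-neighbourhood-bag 𝒯
... | x , v , v⇒∈x = side (splitAt (suc m) v) refl
  where
  side-bounded : (f : Fin (suc m) → Fin (suc m + suc m)) → Injective _≡_ _≡_ f →
                 (∀ i j → ¬ Adj K[ suc m , suc m ] (f i) (f j)) →
                 (∀ i → Adj K[ suc m , suc m ] v (f i)) → suc m ≤ a
  side-bounded f f-injective apart v~f = ≤-trans (≤-reflexive (sym (length-tabulate f)))
    (independent≤α 𝒯 α≡a x (tabulate f)
      (AllPairs.tabulate⁺ λ {i} {j} i≢j → (i≢j ∘ f-injective) , apart i j)
      (All.tabulate⁺ λ i → v⇒∈x (f i) (v~f i)))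

  side : ∀ s → splitAt (suc m) v ≡ s → suc m ≤ a
  side (inj₁ i) eq = side-bounded (suc m ↑ʳ_) (Fin.↑ʳ-injective (suc m) _ _)
    (λ i j → subst₂ (λ p q → ¬ OppositeSides p q)
      (sym (Fin.splitAt-↑ʳ (suc m) (suc m) i)) (sym (Fin.splitAt-↑ʳ (suc m) (suc m) j)) id)
    (λ j → subst₂ OppositeSides (sym eq) (sym (Fin.splitAt-↑ʳ (suc m) (suc m) j)) _)
  side (inj₂ i) eq = side-bounded (_↑ˡ suc m) (Fin.↑ˡ-injective (suc m) _ _)
    (λ i j → subst₂ (λ p q → ¬ OppositeSides p q)
      (sym (Fin.splitAt-↑ˡ (suc m) i (suc m))) (sym (Fin.splitAt-↑ˡ (suc m) j (suc m))) id)
    (λ j → subst₂ OppositeSides (sym eq) (sym (Fin.splitAt-↑ˡ (suc m) j (suc m))) _)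

-- Every vertex is adjacent to one of the two ends of any given edge.
biclique-matching≤1 : ∀ {l m k} → InducedMatching K[ l , m ] k → k ≤ 1
biclique-matching≤1 {k = zero}        M = z≤n
biclique-matching≤1 {k = suc zero}    M = s≤s z≤n
biclique-matching≤1 {l} {k = suc (suc k)} M =
  ⊥-elim ([ induced {suc zero} {zero} (λ ()) (inj₁ refl) (inj₁ refl)
          , induced {suc zero} {zero} (λ ()) (inj₁ refl) (inj₂ refl) ]′
    (opposite-either (splitAt l (left (suc zero))) (splitAt l (left zero))
      (splitAt l (right zero)) (edge zero)))
  where
  open InducedMatching M
  opposite-either : ∀ {l m} (p q r : Fin l ⊎ Fin m) → OppositeSides q r → OppositeSides p q ⊎ OppositeSides p r
  opposite-either (inj₁ _) (inj₁ _) (inj₂ _) _ = inj₂ _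
  opposite-either (inj₁ _) (inj₂ _) (inj₁ _) _ = inj₁ _
  opposite-either (inj₂ _) (inj₁ _) (inj₂ _) _ = inj₁ _
  opposite-either (inj₂ _) (inj₂ _) (inj₁ _) _ = inj₂ _

tree-μ-biclique≤1 : ∀ {l m b} → tree-μ K[ suc l , suc m ] b → b ≤ 1
tree-μ-biclique≤1 {l} {m} {b} (_ , least) = decidable-stable (b ≤? 1) λ b≰1 →
  let 𝒯 = oneBag K[ suc l , suc m ] in
  ¬¬-μ 𝒯 λ (b′ , μ≡b′) → b≰1 (≤-trans (least b′ (𝒯 , μ≡b′)) (μ≤ 𝒯 μ≡b′ 1 λ _ _ M _ → biclique-matching≤1 M))

-- Existence of the parameter values and the equivalence

¬¬-tree-α : (G : Graph (suc n)) → ¬ ¬ ∃ (tree-α G)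
¬¬-tree-α G none = ¬¬-α (oneBag G) λ (a , α≡a) → ¬¬-minimum a (oneBag G , α≡a) none

¬¬-tree-μ : (G : Graph (suc n)) → ¬ ¬ ∃ (tree-μ G)
¬¬-tree-μ G none = ¬¬-μ (oneBag G) λ (b , μ≡b) → ¬¬-minimum b (oneBag G , μ≡b) none

corollary1p2 : ∀ {ℓ} (𝒢 : GraphClass ℓ) → Hereditary 𝒢 →
    FunctionallyEquivalent 𝒢 tree-α tree-μ ⇔ OmitsCompleteBipartite 𝒢
corollary1p2 𝒢 hereditary = mk⇔
  -- As `f` need not be monotone, `f 0 + f 1` bounds it at both possible values of tree-μ; a side
  -- one larger forces tree-α beyond that.
  (λ (f , _ , α≤f , _) → f 0 + f 1 , f 0 + f 1 , λ K∈ →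
    let K = K[ suc (f 0 + f 1) , suc (f 0 + f 1) ] in
    ¬¬-tree-α K λ (a , tα@((𝒯 , α≡a) , _)) → ¬¬-tree-μ K λ (b , tμ) →
    <⇒≱ (biclique-α≥ _ 𝒯 α≡a) (≤-trans (α≤f K K∈ tα tμ) (f≤ f (tree-μ-biclique≤1 tμ))))
  (λ (l , m , K∉) → treeαBound (suc l + suc m) , id ,
    (λ G G∈ → tree-α≤treeαBound (suc l + suc m) (omitted⇒bicliqueFree 𝒢 hereditary K∉ G∈)) ,
    (λ G _ → tree-μ≤tree-α))
  where
  f≤ : ∀ (f : ℕ → ℕ) {b} → b ≤ 1 → f b ≤ f 0 + f 1
  f≤ f {zero}  _         = m≤m+n (f 0) (f 1)
  f≤ f {suc _} (s≤s z≤n) = m≤n+m (f 1) (f 0)
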